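{- Let $\ell,s,n_1,\dots,n_\ell,k_1,\dots,k_\ell$ be positive integers with $n_i\geq 4\ell^2k_i^2s$ for $i=1,\dots,\ell$. Let $V_1,\dots,V_\ell$ be pairwise disjoint sets with $|V_i|=n_i$, and let $\mathcal{F}\subseteq \sqcup_{i=1}^\ell \binom{V_i}{k_i}$. If $\nu(\mathcal{F})\leq s$, then \[ |\mathcal{F}| \leq \max_{1\leq i\leq \ell}\left[\binom{n_i}{k_i}-\binom{n_i-s}{k_i}\right]\prod_{1\leq j\leq \ell,\ j\neq i}\binom{n_j}{k_j}. \]
   Context: For pairwise disjoint finite sets $V_1,\dots,V_\ell$ and integers $k_1,\dots,k_\ell$, the direct product $\sqcup_{i=1}^\ell \binom{V_i}{k_i}$ is the collection of all subsets $F$ of $\bigcup_{i=1}^\ell V_i$ with $|F\cap V_i|=k_i$ for every $i=1,\dots,\ell$. For a family $\mathcal{F}$ of sets, the matching number $\nu(\mathcal{F})$ is the maximum number of pairwise disjoint members of $\mathcal{F}$. -}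

module Defs where

open import Data.Nat using (ℕ; _⊔_; _*_; _∸_)
open import Data.Fin using (Fin; _≟_)
open import Data.Fin.Subset using (Subset; _∩_; Empty; ∣_∣)
open import Data.List using (List; map; foldr; filter; allFin)
open import Data.Nat.ListAction using (product)
open import Data.List.Relation.Unary.All using (All)
open import Data.List.Relation.Unary.AllPairs using (AllPairs)
open import Data.Nat.Combinatorics using (_C_)
open import Relation.Binary.PropositionalEquality using (_≡_)
open import Relation.Nullary using (¬_)
open import Relation.Nullary using (¬?)

-- The ground set is the disjoint union of blocks V_i = Fin (n i), i : Fin ℓ.
-- A subset of ⋃ V_i is given by its traces on each block.
GSet : (ℓ : ℕ) → (Fin ℓ → ℕ) → Set
GSet ℓ n = (i : Fin ℓ) → Subset (n i)

InProduct : {ℓ : ℕ} (n k : Fin ℓ → ℕ) → GSet ℓ n → Set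
InProduct n k F = ∀ i → ∣ F i ∣ ≡ k i

Disjoint : {ℓ : ℕ} {n : Fin ℓ → ℕ} → GSet ℓ n → GSet ℓ n → Set
Disjoint F G = ∀ i → Empty (F i ∩ G i)

Distinct : {ℓ : ℕ} {n : Fin ℓ → ℕ} → GSet ℓ n → GSet ℓ n → Set
Distinct F G = ¬ (∀ i → F i ≡ G i)

IsFamily : {ℓ : ℕ} {n : Fin ℓ → ℕ} → List (GSet ℓ n) → Set
IsFamily 𝓕 = AllPairs Distinct 𝓕

open import Data.List.Membership.Propositional using (_∈_)
open import Data.List using (length)
open import Data.Nat using (_≤_)

MatchingNumberAtMost : {ℓ : ℕ} {n : Fin ℓ → ℕ} → List (GSet ℓ n) → ℕ → Set
MatchingNumberAtMost {ℓ} {n} 𝓕 s =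
  (M : List (GSet ℓ n)) → All (_∈ 𝓕) M → AllPairs Disjoint M → length M ≤ s

maxFin : (ℓ : ℕ) → (Fin ℓ → ℕ) → ℕ
maxFin ℓ f = foldr _⊔_ 0 (map f (allFin ℓ))

prodExcept : (ℓ : ℕ) → Fin ℓ → (Fin ℓ → ℕ) → ℕ
prodExcept ℓ i f = product (map f (filter (λ j → ¬? (j ≟ i)) (allFin ℓ)))

bound : (ℓ s : ℕ) (n k : Fin ℓ → ℕ) → ℕ
bound ℓ s n k =
  maxFin ℓ (λ i → ((n i C k i) ∸ ((n i ∸ s) C k i)) * prodExcept ℓ i (λ j → n j C k j))

{-# OPTIONS --safe #-}
module Submission where

-- Give a vertex v of V_i the weight x_v = k_i / n_i. The product family is spread: at most N ∏_{v ∈ B} x_v of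
-- its N members contain a given set B. All counts are compared with such weights, over the common denominator
-- L = ∏ n_j (so X v = L x_v), and the hypothesis makes s ∑_{v ∈ F} x_v at most 1/4 for every edge F.
--
-- Let H be the set of vertices of very large degree. Edges through distinct vertices of H can be picked greedily,
-- so |H| ≤ s and the edges that avoid H contain no matching of size r + 1, where r = s - |H|. Among these edges
-- at most r vertices have degree above a second, lower threshold: otherwise the links of r + 1 such vertices would
-- contain a rainbow matching, by an induction on the size of the edges that again separates the families with a
-- vertex of large degree (pass to links) from the others (choose greedily). Deleting these r vertices leaves
-- small degrees, hence few edges, so that only (1 - 1/(4q)) r (max x_v) N edges avoid H, with q = k_1 if ℓ = 1
-- and q = 2 otherwise.
--
-- Finally r more vertices of the block with the largest k_i / n_i would meet more edges of the full product than
-- that, so |𝓕| is at most the number of members of the product that meet a set of s vertices. By log-concavity of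
-- t ↦ C(n_i - t, k_i) that number is largest when the s vertices lie in a single block.

open import Data.Nat using (ℕ; zero; suc; _+_; _*_; _∸_; _^_; _≤_; _<_; z≤n; s≤s; NonZero; _<?_; _⊔_; >-nonZero)
open import Data.Nat.Properties hiding (_≟_)
open import Data.Nat.ListAction using (sum; product)
open import Data.Nat.Tactic.RingSolver using (solve-∀)
open import Data.List using (List; []; _∷_; _++_; [_]; length; map; filter; concatMap; take; tabulate; allFin; foldr; deduplicate)
open import Data.List.Properties using (length-map; length-filter; filter-notAll; length-take; length-++; ++-identityʳ; map-tabulate; map-cong-local)
open import Data.List.Membership.Propositional using (_∈_; _∉_; find)
open import Data.List.Membership.Propositional.Properties using (∈-map⁺; ∈-map⁻; ∈-filter⁺; ∈-filter⁻; ∈-++⁺ˡ; ∈-++⁺ʳ; ∈-++⁻; ∈-concatMap⁺; ∈-concatMap⁻; ∈-allFin; ∈-deduplicate⁺)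
open import Data.List.Relation.Unary.All as All using (All; []; _∷_)
open import Data.List.Relation.Unary.Any as Any using (Any; here; there)
open import Data.List.Relation.Unary.AllPairs as AllPairs using (AllPairs; []; _∷_)
open import Data.List.Relation.Unary.Unique.Propositional using (Unique)
open import Data.List.Relation.Binary.Permutation.Propositional using (_↭_; ↭-refl; ↭-sym; ↭-trans; prep; ↭⇒↭ₛ)
open import Data.List.Relation.Binary.Permutation.Propositional.Properties using (∈-resp-↭; ↭-length; shift)
open import Data.List.Relation.Binary.Permutation.Setoid.Properties using (AllPairs-resp-↭)
import Data.List.Relation.Unary.All.Properties as Allₚ
import Data.List.Relation.Unary.Unique.Propositional.Properties as Uniqueₚ
open import Data.Product using (Σ; ∃; _×_; _,_; proj₁; proj₂)
open import Data.Sum using (_⊎_; inj₁; inj₂; [_,_]′)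
open import Data.Empty using (⊥; ⊥-elim)
open import Function using (_∘_; id; const)
open import Relation.Nullary using (¬_; Dec; yes; no; contradiction; ¬?; _×-dec_; does)
open import Relation.Unary using (Decidable)
open import Relation.Binary.Definitions using (DecidableEquality)
open import Relation.Binary.PropositionalEquality using (_≡_; _≢_; refl; sym; trans; cong; cong₂; subst; setoid; subst₂)
import Data.List.Membership.DecPropositional as DecMem
open import Defs
open import Data.Bool using (true; false; if_then_else_)
open import Data.Fin as Fin using (Fin; zero; suc)
import Data.Fin.Properties as Finₚ
open import Data.Fin.Subset using (Subset; Side; inside; outside; ∣_∣)
open import Data.Fin.Subset.Properties using (x∈p∩q⁻)
import Data.Vec as Vec
import Data.Vec.Properties as Vecₚ
open import Data.Nat.Combinatorics using (_C_; k>n⇒nCk≡0; nC1≡n; nCk+nC[k+1]≡[n+1]C[k+1])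
open import Data.Unit using (⊤; tt)
import Data.List.Relation.Unary.Any.Properties as Anyₚ
import Data.List.Relation.Unary.AllPairs.Properties as AllPairsₚ
open import Data.Product.Properties using (≡-dec)
open import Data.List.Relation.Unary.Unique.DecPropositional.Properties using (deduplicate-!)
open ≤-Reasoning

-- Counting and summing over lists

private variable
  A : Set

count : {P : A → Set} → Decidable P → List A → ℕ
count P? xs = length (filter P? xs)

count-∪ : {P Q R : A → Set} (P? : Decidable P) (Q? : Decidable Q) (R? : Decidable R) (xs : List A) →
  (∀ {x} → x ∈ xs → P x → Q x ⊎ R x) → count P? xs ≤ count Q? xs + count R? xs
count-∪ P? Q? R? [] _ = z≤n
count-∪ P? Q? R? (x ∷ xs) P⊆Q∪R with ih ← count-∪ P? Q? R? xs (P⊆Q∪R ∘ there) | P? x | Q? x | R? x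
... | no _  | no _  | no _  = ih
... | no _  | yes _ | no _  = m≤n⇒m≤1+n ih
... | no _  | no _  | yes _ = ≤-trans ih (+-monoʳ-≤ _ (n≤1+n _))
... | no _  | yes _ | yes _ = m≤n⇒m≤1+n (≤-trans ih (+-monoʳ-≤ _ (n≤1+n _)))
... | yes p | no ¬q | no ¬r = ⊥-elim ([ ¬q , ¬r ]′ (P⊆Q∪R (here refl) p))
... | yes _ | yes _ | no _  = s≤s ih
... | yes _ | no _  | yes _ = ≤-trans (s≤s ih) (≤-reflexive (sym (+-suc _ _)))
... | yes _ | yes _ | yes _ = s≤s (≤-trans ih (+-monoʳ-≤ _ (n≤1+n _)))

count-mono : {P Q : A → Set} (P? : Decidable P) (Q? : Decidable Q) (xs : List A) →
  (∀ {x} → x ∈ xs → P x → Q x) → count P? xs ≤ count Q? xs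
count-mono P? Q? [] _ = z≤n
count-mono P? Q? (x ∷ xs) P⊆Q with ih ← count-mono P? Q? xs (P⊆Q ∘ there) | P? x | Q? x
... | no _  | no _  = ih
... | no _  | yes _ = m≤n⇒m≤1+n ih
... | yes p | no ¬q = contradiction (P⊆Q (here refl) p) ¬q
... | yes _ | yes _ = s≤s ih

count-witness : {P : A → Set} (P? : Decidable P) (xs : List A) → 0 < count P? xs → ∃ λ x → x ∈ xs × P x
count-witness P? xs 0<c with filter P? xs in eq
... | x ∷ _ = x , ∈-filter⁻ P? {xs = xs} (subst (x ∈_) (sym eq) (here refl))

sumBy : (A → ℕ) → List A → ℕ
sumBy f xs = sum (map f xs)

sumBy-++ : (f : A → ℕ) (xs ys : List A) → sumBy f (xs ++ ys) ≡ sumBy f xs + sumBy f ys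
sumBy-++ f [] ys = refl
sumBy-++ f (x ∷ xs) ys = trans (cong (f x +_) (sumBy-++ f xs ys)) (sym (+-assoc (f x) _ _))

sumBy-filter : {P : A → Set} (f : A → ℕ) (P? : Decidable P) (xs : List A) → sumBy f (filter P? xs) ≤ sumBy f xs
sumBy-filter f P? [] = z≤n
sumBy-filter f P? (x ∷ xs) with P? x
... | yes _ = +-monoʳ-≤ (f x) (sumBy-filter f P? xs)
... | no _  = ≤-trans (sumBy-filter f P? xs) (m≤n+m _ _)

sumBy-bounded : (f : A → ℕ) (b : ℕ) (xs : List A) → (∀ {x} → x ∈ xs → f x ≤ b) → sumBy f xs ≤ length xs * b
sumBy-bounded f b [] _ = z≤n
sumBy-bounded f b (x ∷ xs) f≤b = +-mono-≤ (f≤b (here refl)) (sumBy-bounded f b xs (f≤b ∘ there))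

sumBy-concatMap : {B : Set} (f : B → ℕ) (g : A → List B) (b : ℕ) (xs : List A) →
  (∀ {x} → x ∈ xs → sumBy f (g x) ≤ b) → sumBy f (concatMap g xs) ≤ length xs * b
sumBy-concatMap f g b [] _ = z≤n
sumBy-concatMap f g b (x ∷ xs) h = begin
  sumBy f (g x ++ concatMap g xs)              ≡⟨ sumBy-++ f (g x) _ ⟩
  sumBy f (g x) + sumBy f (concatMap g xs)     ≤⟨ +-mono-≤ (h (here refl)) (sumBy-concatMap f g b xs (h ∘ there)) ⟩
  b + length xs * b                            ∎

Unique-head : {x : A} {xs : List A} → Unique (x ∷ xs) → x ∉ xs
Unique-head (x≢ ∷ _) x∈ = All.lookup x≢ x∈ refl

∈-take : ∀ n {x : A} {xs} → x ∈ take n xs → x ∈ xs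
∈-take (suc n) {xs = _ ∷ _} (here p) = here p
∈-take (suc n) {xs = _ ∷ _} (there p) = there (∈-take n p)

length-take≤ : ∀ {n} (xs : List A) → n ≤ length xs → length (take n xs) ≡ n
length-take≤ {n = n} xs n≤ = trans (length-take n xs) (m≤n⇒m⊓n≡m n≤)

Unique-resp-↭ : {xs ys : List A} → xs ↭ ys → Unique xs → Unique ys
Unique-resp-↭ {A} p = AllPairs-resp-↭ (setoid A) (λ x≢y → x≢y ∘ sym) ((λ { refl → id }) , (λ { refl → id })) (↭⇒↭ₛ p)

-- Rainbow matchings in spread families

module Hypergraph {V E : Set} (_≟_ : DecidableEquality V) (verts : E → List V) (𝓕 : List E) (X : V → ℕ) where

  open DecMem _≟_ using (_∈?_; _∉?_)

  Avoids : List V → E → Set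
  Avoids Z e = All (_∉ verts e) Z

  avoids? : ∀ Z → Decidable (Avoids Z)
  avoids? Z e = All.all? (_∉? verts e) Z

  has? : ∀ v → Decidable (λ e → v ∈ verts e)
  has? v e = v ∈? verts e

  infixr 5 _∧?_
  _∧?_ : {P Q : E → Set} → Decidable P → Decidable Q → Decidable (λ e → P e × Q e)
  (P? ∧? Q?) e = P? e ×-dec Q? e

  _#_ : E → E → Set
  e # f = ∀ {v} → v ∈ verts e → v ∉ verts f

  deg : {P : E → Set} → Decidable P → V → ℕ
  deg P? v = count (P? ∧? has? v) 𝓕

  others : V → List V → List V
  others v = filter (λ u → ¬? (u ≟ v))

  length-others : ∀ {v us n} → v ∈ us → length us ≤ suc n → length (others v us) ≤ n
  length-others {v} {us} v∈ len = ≤-pred (≤-trans (filter-notAll _ us (Any.map (λ eq ¬eq → ¬eq (sym eq)) v∈)) len)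

  rest : List V → E → List V
  rest [] e = verts e
  rest (v ∷ B) e = others v (rest B e)

  ∈-rest : ∀ {v} B {e} → v ∈ verts e → v ∉ B → v ∈ rest B e
  ∈-rest [] v∈ _ = v∈
  ∈-rest (u ∷ B) v∈ v∉ = ∈-filter⁺ _ (∈-rest B v∈ (v∉ ∘ there)) (v∉ ∘ here)

  rest⁻ : ∀ {v} B {e} → v ∈ rest B e → v ∈ verts e × v ∉ B
  rest⁻ [] v∈ = v∈ , λ ()
  rest⁻ {v} (u ∷ B) {e} v∈ with v∈′ , v≢u ← ∈-filter⁻ (λ w → ¬? (w ≟ u)) {xs = rest B e} v∈
    with v∈e , v∉B ← rest⁻ B v∈′ = v∈e , λ { (here v≡u) → v≢u v≡u ; (there v∈B) → v∉B v∈B }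

  avoid-∷ : {P : E → Set} (P? : Decidable P) (v : V) (Z : List V) →
    count (P? ∧? avoids? Z) 𝓕 ≤ deg P? v + count (P? ∧? avoids? (v ∷ Z)) 𝓕
  avoid-∷ {P} P? v Z = count-∪ (P? ∧? avoids? Z) (P? ∧? has? v) (P? ∧? avoids? (v ∷ Z)) 𝓕 split
    where
    split : ∀ {e} → e ∈ 𝓕 → P e × Avoids Z e → (P e × v ∈ verts e) ⊎ (P e × Avoids (v ∷ Z) e)
    split {e} _ (p , av) with v ∈? verts e
    ... | yes v∈ = inj₁ (p , v∈)
    ... | no v∉  = inj₂ (p , v∉ ∷ av)

  -- A union bound: each deleted star costs its degree, at most `b`/`a` times the weight of its
  -- centre. The factor `a` clears denominators, since all bounds are fractions over powers of `L`.
  count-avoid : {P : E → Set} (P? : Decidable P) (a b : ℕ) (Z : List V) →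
    (∀ {v} → v ∈ Z → deg P? v * a ≤ b * X v) →
    count P? 𝓕 * a ≤ count (P? ∧? avoids? Z) 𝓕 * a + b * sumBy X Z
  count-avoid P? a b [] _ = ≤-trans (*-monoˡ-≤ a (count-mono P? (P? ∧? avoids? []) 𝓕 (λ _ p → p , []))) (m≤m+n _ _)
  count-avoid P? a b (v ∷ Z) h = begin
    count P? 𝓕 * a
      ≤⟨ count-avoid P? a b Z (h ∘ there) ⟩
    count (P? ∧? avoids? Z) 𝓕 * a + b * sumBy X Z
      ≤⟨ +-monoˡ-≤ _ (*-monoˡ-≤ a (avoid-∷ P? v Z)) ⟩
    (deg P? v + c) * a + b * sumBy X Z
      ≡⟨ lem (deg P? v) c a _ ⟩
    deg P? v * a + (c * a + b * sumBy X Z)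
      ≤⟨ +-monoˡ-≤ _ (h (here refl)) ⟩
    b * X v + (c * a + b * sumBy X Z)
      ≡⟨ lem₂ b (X v) (c * a) (sumBy X Z) ⟩
    c * a + b * (X v + sumBy X Z) ∎
    where
    c = count (P? ∧? avoids? (v ∷ Z)) 𝓕
    lem : ∀ d c a y → (d + c) * a + y ≡ d * a + (c * a + y)
    lem = solve-∀
    lem₂ : ∀ b x c y → b * x + (c + b * y) ≡ c + b * (x + y)
    lem₂ = solve-∀

  find-avoiding : {P : E → Set} (P? : Decidable P) (a b : ℕ) (Z : List V) →
    (∀ {v} → v ∈ Z → deg P? v * a ≤ b * X v) → b * sumBy X Z < count P? 𝓕 * a →
    ∃ λ e → e ∈ 𝓕 × P e × Avoids Z e
  find-avoiding P? a b Z h lt = count-witness (P? ∧? avoids? Z) 𝓕 (pos _ (+-cancelʳ-< (b * sumBy X Z) 0 _ (<-≤-trans lt (count-avoid P? a b Z h))))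
    where
    pos : ∀ c → 0 < c * a → 0 < c
    pos (suc c) _ = s≤s z≤n

  Contains : List V → E → Set
  Contains B e = All (_∈ verts e) B

  contains? : ∀ B → Decidable (Contains B)
  contains? B e = All.all? (_∈? verts e) B

  module Spread (vertices : List V) (complete : ∀ v → v ∈ vertices)
    (L N Xm : ℕ) {{_ : NonZero L}} (X≤Xm : ∀ v → X v ≤ Xm) where

    -- The quotient `weight B` / `scale B` is N times the product of X v / L over v in B, the spread
    -- bound on the number of edges through B. Numerator and denominator are kept apart to stay in
    -- the natural numbers.
    scale weight : List V → ℕ
    scale [] = 1
    scale (v ∷ B) = L * scale B
    weight [] = N
    weight (v ∷ B) = X v * weight B

    module _ (spread : ∀ {B} → Unique B → count (contains? B) 𝓕 * scale B ≤ weight B) where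

      deg-spread : {P : E → Set} (P? : Decidable P) (B : List V) (v : V) →
        (∀ {e} → P e → Contains B e) → Unique B → v ∉ B → deg P? v * scale (v ∷ B) ≤ X v * weight B
      deg-spread P? B v P⊆ uB v∉B = ≤-trans
        (*-monoˡ-≤ _ (count-mono (P? ∧? has? v) (contains? (v ∷ B)) 𝓕 (λ _ (p , v∈) → v∈ ∷ P⊆ p)))
        (spread (All.tabulate (λ u∈ v≡u → v∉B (subst (_∈ B) (sym v≡u) u∈)) ∷ uB))

      -- By spreadness a star with centre outside `B` has at most Xm / L times the mass of `B`, so
      -- deleting `m` of them lowers the density by at most m Xm / L.
      star-loss : {P : E → Set} (P? : Decidable P) (B us : List V) (m : ℕ) →
        (∀ {e} → P e → Contains B e) → Unique B → (∀ {u} → u ∈ us → u ∉ B) → length us ≤ m →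
        count P? 𝓕 * (L * scale B) ≤ count (P? ∧? avoids? us) 𝓕 * (L * scale B) + weight B * (m * Xm)
      star-loss P? B us m P⊆ uB us∉B len = ≤-trans
        (count-avoid P? (L * scale B) (weight B) us
          (λ {v} v∈ → ≤-trans (deg-spread P? B v P⊆ uB (us∉B v∈)) (≤-reflexive (*-comm (X v) _))))
        (+-monoʳ-≤ _ (*-monoʳ-≤ (weight B)
          (≤-trans (sumBy-bounded X Xm us (λ {v} _ → X≤Xm v)) (*-monoˡ-≤ Xm len))))

      module Levels (S D μ : ℕ) where

        -- Passing to the link of `v` enlarges the fixed set by `v`. Keeping it apart from the at
        -- most `μ` vertices `us` costs at most one unit of the coefficient, which drops from (S +
        -- 2D)/D to (S + D)/D.
        link-dense : {P : E → Set} (P? : Decidable P) (B : List V) (v : V) (us : List V) →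
          (∀ {e} → P e → Contains B e) → Unique B → v ∉ B →
          (∀ {u} → u ∈ us → u ≢ v × u ∉ B) → length us ≤ μ →
          (S + D + D) * μ * Xm * (X v * weight B) < deg P? v * (L * scale (v ∷ B)) * D →
          (S + D) * μ * Xm * weight (v ∷ B) <
            count ((P? ∧? has? v) ∧? avoids? us) 𝓕 * (L * scale (v ∷ B)) * D
        link-dense P? B v us P⊆ uB v∉B us∉ len high = +-cancelʳ-< (W * (μ * Xm) * D) _ _ (begin-strict
          (S + D) * μ * Xm * W + W * (μ * Xm) * D
            ≡⟨ lem S D μ Xm W ⟩
          (S + D + D) * μ * Xm * W
            <⟨ high ⟩
          deg P? v * a * D
            ≤⟨ *-monoˡ-≤ D (star-loss (P? ∧? has? v) (v ∷ B) us μ (λ (q , v∈) → v∈ ∷ P⊆ q)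
                 (All.tabulate (λ u∈ v≡u → v∉B (subst (_∈ B) (sym v≡u) u∈)) ∷ uB)
                 (λ u∈ → λ { (here u≡v) → proj₁ (us∉ u∈) u≡v ; (there u∈B) → proj₂ (us∉ u∈) u∈B }) len) ⟩
          (c * a + W * (μ * Xm)) * D
            ≡⟨ *-distribʳ-+ D (c * a) _ ⟩
          c * a * D + W * (μ * Xm) * D ∎)
          where
          W = weight (v ∷ B)
          a = L * scale (v ∷ B)
          c = count ((P? ∧? has? v) ∧? avoids? us) 𝓕
          lem : ∀ S D μ x W → (S + D) * μ * x * W + W * (μ * x) * D ≡ (S + D + D) * μ * x * W
          lem = solve-∀

      update : {I : Set} → (V → I) → V → I → V → I
      update f i x j with j ≟ i
      ... | yes _ = x
      ... | no _  = f j

      update-same : {I : Set} (f : V → I) (i : V) (x : I) → update f i x i ≡ x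
      update-same f i x with i ≟ i
      ... | yes _ = refl
      ... | no i≢i = contradiction refl i≢i

      update-other : {I : Set} (f : V → I) {i j : V} (x : I) → j ≢ i → update f i x j ≡ f j
      update-other f {i} {j} x j≢i with j ≟ i
      ... | yes j≡i = contradiction j≡i j≢i
      ... | no _ = refl

      -- Relative to the weight of B, a family is dense above the density ((S + D)/D) μ Xm / L, and a vertex v is high
      -- above ((S + 2D)/D) μ Xm X v / L². The difference of the two coefficients is 1: it pays for the at most μ stars
      -- removed from a link. The number c = (S + D)/D solves c = 1 + ε (c + 1), where ε = S/(S + 2D) bounds μ Y / L.
      module Rainbow (S D μ Y : ℕ) (Y-small : (S + D + D) * (μ * Y) ≤ S * L) (e₀ : E) where

        open Levels S D μ

        -- The state of the induction: the members of family i contain a fixed set `B i`, and the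
        -- bound `d` on the remainder of an edge is the induction measure. By `separate`, edges of
        -- different families can meet only outside both fixed sets.
        record Tasks (d : ℕ) (is : List V) (B : V → List V) {P : V → E → Set} (P? : ∀ i → Decidable (P i)) : Set where
          field
            unique : ∀ {i} → i ∈ is → Unique (B i)
            contains : ∀ {i e} → i ∈ is → P i e → Contains (B i) e
            separate : ∀ {i j e} → i ∈ is → j ∈ is → i ≢ j → P i e → Avoids (B j) e
            light : ∀ {i e} → i ∈ is → e ∈ 𝓕 → P i e → sumBy X (rest (B i) e) ≤ Y
            short : ∀ {i e} → i ∈ is → e ∈ 𝓕 → P i e → length (rest (B i) e) < d
            dense : ∀ {i} → i ∈ is →
              (S + D) * μ * Xm * weight (B i) < count (P? i) 𝓕 * (L * scale (B i)) * D

        record Chosen (is : List V) (P : V → E → Set) : Set where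
          field
            edge : V → E
            edge∈ : ∀ {i} → i ∈ is → edge i ∈ 𝓕
            edge-P : ∀ {i} → i ∈ is → P i (edge i)
            disjoint : ∀ {i j} → i ∈ is → j ∈ is → i ≢ j → edge i # edge j

        module _ (B : V → List V) {P : V → E → Set} (P? : ∀ i → Decidable (P i)) where

          High : V → V → Set
          High i v = (S + D + D) * μ * Xm * (X v * weight (B i)) <
            deg (P? i) v * (L * scale (v ∷ B i)) * D

          -- Here `pick` is a system of distinct representatives: each index in `highs` has a
          -- private high vertex. An index in `lows` sees no high vertex outside the picked ones and
          -- its fixed set, which is what the greedy choice needs.
          record Choice (js : List V) : Set where
            field
              highs lows : List V
              pick : V → V
              perm : js ↭ lows ++ highs
              injective : ∀ {i j} → i ∈ highs → j ∈ highs → i ≢ j → pick i ≢ pick j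
              high : ∀ {i} → i ∈ highs → pick i ∉ B i × High i (pick i)
              low : ∀ {i v} → i ∈ lows → v ∉ map pick highs → v ∉ B i → ¬ High i v

          -- One pass suffices: an index is declared low relative to the vertices picked so far, and
          -- later picks only enlarge the set of exempted vertices.
          choose : ∀ js → Unique js → Choice js
          choose [] _ = record { highs = [] ; lows = [] ; pick = id ; perm = ↭-refl
            ; injective = λ () ; high = λ () ; low = λ () }
          choose (i ∷ js) (i≢ ∷ u) with choose js u
          ... | ch with Any.any? (λ v → ¬? (v ∈? map (Choice.pick ch) (Choice.highs ch)) ×-dec ¬? (v ∈? B i) ×-dec (_ <? _)) vertices
          ... | no none = record
            { Choice ch
            ; lows = i ∷ lows
            ; perm = prep i perm
            ; low = λ { {v = v} (here refl) v∉U v∉B h → none (Any.map (λ { refl → v∉U , v∉B , h }) (complete v))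
                      ; (there j∈) → low j∈ }
            }
            where open Choice ch
          ... | yes some with v , v∉U , v∉B , h ← Any.satisfied some = record
            { highs = i ∷ highs
            ; lows = lows
            ; pick = pick′
            ; perm = ↭-trans (prep i perm) (↭-sym (shift i lows highs))
            ; injective = inj
            ; high = hi
            ; low = lo
            }
            where
            open Choice ch
            pick′ = update pick i v
            ≢i : ∀ {j} → j ∈ highs → j ≢ i
            ≢i j∈ j≡i = All.lookup i≢ (∈-resp-↭ (↭-sym perm) (∈-++⁺ʳ lows j∈)) (sym j≡i)
            old : ∀ {j} → j ∈ highs → pick′ j ≡ pick j
            old j∈ = update-other pick v (≢i j∈)
            new : pick′ i ≡ v
            new = update-same pick i v
            v≢ : ∀ {j} → j ∈ highs → v ≢ pick j
            v≢ j∈ refl = v∉U (∈-map⁺ pick j∈)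
            inj : ∀ {j k} → j ∈ i ∷ highs → k ∈ i ∷ highs → j ≢ k → pick′ j ≢ pick′ k
            inj (here refl) (here refl) j≢k = contradiction refl j≢k
            inj (here refl) (there k∈) _ eq = v≢ k∈ (trans (sym new) (trans eq (old k∈)))
            inj (there j∈) (here refl) _ eq = v≢ j∈ (trans (sym new) (trans (sym eq) (old j∈)))
            inj (there j∈) (there k∈) j≢k eq = injective j∈ k∈ j≢k (trans (sym (old j∈)) (trans eq (old k∈)))
            hi : ∀ {j} → j ∈ i ∷ highs → pick′ j ∉ B j × High j (pick′ j)
            hi (here refl) = subst (λ w → w ∉ B i × High i w) (sym new) (v∉B , h)
            hi {j} (there j∈) = subst (λ w → w ∉ B j × High j w) (sym (old j∈)) (high j∈)
            lo : ∀ {j w} → j ∈ lows → w ∉ map pick′ (i ∷ highs) → w ∉ B j → ¬ High j w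
            lo {w = w} j∈ w∉ = low j∈ λ w∈ → case (∈-map⁻ pick w∈)
              where
              case : ∃ (λ k → k ∈ highs × w ≡ pick k) → ⊥
              case (k , k∈ , eq) = w∉ (there (subst (_∈ map pick′ highs) (trans (old k∈) (sym eq)) (∈-map⁺ pick′ k∈)))

          -- After deleting U every degree in the i-th family is small, so a greedy choice succeeds.
          candidate : ∀ {d is} → Tasks d is B P? → (U done : List V) (i : V) →
            i ∈ is → i ∉ done → (∀ {j} → j ∈ done → j ∈ is) → length done ≤ μ →
            length U ≤ μ → (∀ {u} → u ∈ U → u ∉ B i) →
            (∀ {v} → v ∉ U → v ∉ B i → ¬ High i v) →
            (ch : Chosen done P) →
            ∃ λ e → e ∈ 𝓕 × P i e × (∀ {j} → j ∈ done → Chosen.edge ch j # e)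
          candidate T U done i i∈ i∉ done⊆ |done| |U| U∉B low ch =
            finish (find-avoiding P°? a′ b Z low-deg enough)
            where
            open Tasks T
            open Chosen ch
            W = weight (B i)
            a = L * scale (B i)
            -- Only the parts outside the fixed sets have to be avoided: members of family i miss
            -- `B j` by `separate`.
            Z = concatMap (λ j → rest (B j) (edge j)) done
            P°? = P? i ∧? avoids? U
            c° = count P°? 𝓕
            ≢i : ∀ {j} → j ∈ done → j ≢ i
            ≢i j∈ refl = i∉ j∈

            Z-sum : sumBy X Z ≤ μ * Y
            Z-sum = ≤-trans (sumBy-concatMap X (λ j → rest (B j) (edge j)) Y done
              (λ j∈ → light (done⊆ j∈) (edge∈ j∈) (edge-P j∈))) (*-monoˡ-≤ Y |done|)

            -- Deleting the stars of `U` uses up the D in the coefficient S + D and leaves S.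
            many : S * μ * Xm * W < c° * a * D
            many = +-cancelʳ-< (W * (μ * Xm) * D) _ _ (begin-strict
              S * μ * Xm * W + W * (μ * Xm) * D  ≡⟨ lem S D μ Xm W ⟩
              (S + D) * μ * Xm * W               <⟨ dense i∈ ⟩
              count (P? i) 𝓕 * a * D                 ≤⟨ *-monoˡ-≤ D (star-loss (P? i) (B i) U μ (contains i∈) (unique i∈) U∉B |U|) ⟩
              (c° * a + W * (μ * Xm)) * D            ≡⟨ *-distribʳ-+ D (c° * a) _ ⟩
              c° * a * D + W * (μ * Xm) * D          ∎)
              where
              lem : ∀ S D μ x W → S * μ * x * W + W * (μ * x) * D ≡ (S + D) * μ * x * W
              lem = solve-∀

            Z∉B : ∀ {v} → v ∈ Z → v ∉ B i
            Z∉B v∈ v∈B with j , j∈ , v∈r ← find (∈-concatMap⁻ (λ j → rest (B j) (edge j)) {xs = done} v∈) =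
              All.lookup (separate (done⊆ j∈) i∈ (≢i j∈) (edge-P j∈)) v∈B (proj₁ (rest⁻ (B j) v∈r))

            b = (S + D + D) * μ * Xm * W
            a′ = L * a * D

            -- A vertex of `U` has degree 0 after the deletion; a vertex of `Z` outside `U` lies
            -- outside `B i` too and is not high.
            low-deg : ∀ {v} → v ∈ Z → deg P°? v * a′ ≤ b * X v
            low-deg {v} v∈ with v ∈? U
            ... | yes v∈U = ≤-trans (≤-reflexive (cong (_* a′) (n≤0⇒n≡0 none))) z≤n
              where
              none : deg P°? v ≤ 0
              none with deg P°? v in eq
              ... | zero = z≤n
              ... | suc _ with e , _ , (_ , av) , v∈e ← count-witness (P°? ∧? has? v) 𝓕 (subst (0 <_) (sym eq) (s≤s z≤n)) =
                contradiction v∈e (All.lookup av v∈U)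
            ... | no v∉U = begin
              deg P°? v * (L * a * D)                       ≤⟨ *-monoˡ-≤ a′ (count-mono (P°? ∧? has? v) (P? i ∧? has? v) 𝓕 (λ _ ((q , _) , v∈e) → q , v∈e)) ⟩
              deg (P? i) v * (L * a * D)                    ≡⟨ *-assoc (deg (P? i) v) (L * a) D ⟨
              deg (P? i) v * (L * a) * D                    ≤⟨ ≮⇒≥ (low v∉U (Z∉B v∈)) ⟩
              (S + D + D) * μ * Xm * (X v * W)              ≡⟨ lem ((S + D + D) * μ * Xm) (X v) W ⟩
              b * X v                                       ∎
              where
              lem : ∀ y x W → y * (x * W) ≡ y * W * x
              lem = solve-∀

            -- The vertices of `Z` weigh at most `μ * Y`, and by `Y-small` this times S + 2D is at
            -- most S L, exactly what `many` retains.
            enough : b * sumBy X Z < c° * a′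
            enough = begin-strict
              b * sumBy X Z                                 ≤⟨ *-monoʳ-≤ b Z-sum ⟩
              (S + D + D) * μ * Xm * W * (μ * Y)            ≡⟨ lem (S + D + D) μ Xm W (μ * Y) ⟩
              μ * Xm * W * ((S + D + D) * (μ * Y))      ≤⟨ *-monoʳ-≤ (μ * Xm * W) Y-small ⟩
              μ * Xm * W * (S * L)                      ≡⟨ lem₂ S μ Xm W L ⟩
              S * μ * Xm * W * L                        <⟨ *-monoˡ-< L many ⟩
              c° * a * D * L                                ≡⟨ lem₃ c° a D L ⟩
              c° * a′                                       ∎
              where
              lem : ∀ G μ x W m → G * μ * x * W * m ≡ μ * x * W * (G * m)
              lem = solve-∀
              lem₂ : ∀ S μ x W L → μ * x * W * (S * L) ≡ S * μ * x * W * L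
              lem₂ = solve-∀
              lem₃ : ∀ c a D L → c * a * D * L ≡ c * (L * a * D)
              lem₃ = solve-∀

            -- A vertex shared with the earlier edge j lies either in `B j`, excluded by `separate`,
            -- or in `Z`, excluded by the choice of `e`.
            apart : ∀ {j v e} → j ∈ done → v ∈ verts (edge j) → v ∈ verts e → P i e → Avoids Z e → ⊥
            apart {j} {v} j∈ v∈ v∈e Pe avZ with v ∈? B j
            ... | yes v∈B = All.lookup (separate i∈ (done⊆ j∈) (≢i j∈ ∘ sym) Pe) v∈B v∈e
            ... | no v∉B = All.lookup avZ (∈-concatMap⁺ _ (Any.map (λ { refl → ∈-rest (B j) v∈ v∉B }) j∈)) v∈e

            finish : (∃ λ e → e ∈ 𝓕 × (P i e × Avoids U e) × Avoids Z e) →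
              ∃ λ e → e ∈ 𝓕 × P i e × (∀ {j} → j ∈ done → edge j # e)
            finish (e , e∈ , (Pe , _) , avZ) = e , e∈ , Pe , λ j∈ v∈ v∈e → apart j∈ v∈ v∈e Pe avZ

          add : ∀ {done i e} → i ∉ done → e ∈ 𝓕 → P i e → (ch : Chosen done P) →
            (∀ {j} → j ∈ done → Chosen.edge ch j # e) → Chosen (i ∷ done) P
          add {done} {i} {e} i∉ e∈ Pe ch apart = record
            { edge = edge′
            ; edge∈ = λ { (here refl) → subst (_∈ 𝓕) (sym new) e∈ ; (there j∈) → subst (_∈ 𝓕) (sym (old j∈)) (edge∈ j∈) }
            ; edge-P = λ { (here refl) → subst (P i) (sym new) Pe
                         ; {j} (there j∈) → subst (P j) (sym (old j∈)) (edge-P j∈) }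
            ; disjoint = dis
            }
            where
            open Chosen ch
            edge′ = update edge i e
            new : edge′ i ≡ e
            new = update-same edge i e
            old : ∀ {j} → j ∈ done → edge′ j ≡ edge j
            old j∈ = update-other edge e (λ { refl → i∉ j∈ })

            dis : ∀ {j k} → j ∈ i ∷ done → k ∈ i ∷ done → j ≢ k → edge′ j # edge′ k
            dis (here refl) (here refl) j≢k = contradiction refl j≢k
            dis (here refl) (there k∈) _ rewrite new | old k∈ = λ v∈ v∈k → apart k∈ v∈k v∈
            dis (there j∈) (here refl) _ rewrite new | old j∈ = apart j∈
            dis (there j∈) (there k∈) j≢k rewrite old j∈ | old k∈ = disjoint j∈ k∈ j≢k

        module Step {d : ℕ} {is : List V} (B : V → List V) {P : V → E → Set} (P? : ∀ i → Decidable (P i))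
          (uis : Unique is) (len : length is ≤ suc μ) (T : Tasks (suc d) is B P?) (ch : Choice B P? is) where

          open Tasks T
          open Choice ch using (highs; lows; pick; perm; injective; high; low) public
          U = map pick highs
          into : ∀ {i} → i ∈ is → i ∈ lows ++ highs
          into = ∈-resp-↭ perm
          from : ∀ {i} → i ∈ lows ++ highs → i ∈ is
          from = ∈-resp-↭ (↭-sym perm)
          fromʰ : ∀ {i} → i ∈ highs → i ∈ is
          fromʰ = from ∘ ∈-++⁺ʳ lows
          uniq : Unique (lows ++ highs)
          uniq = Unique-resp-↭ perm uis
          size : length lows + length highs ≤ suc μ
          size = subst (_≤ suc μ) (trans (↭-length perm) (length-++ lows)) len

          -- The edge for i is to contain its own picked vertex and to miss the other ones, so that
          -- the enlarged fixed sets stay separated.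
          P′ : V → E → Set
          P′ i e = (P i e × pick i ∈ verts e) × Avoids (others (pick i) U) e
          P′? : ∀ i → Decidable (P′ i)
          P′? i = (P? i ∧? has? (pick i)) ∧? avoids? (others (pick i) U)
          B′ : V → List V
          B′ i = pick i ∷ B i

          positive : ∀ c {a x} → x < c * a * D → 0 < c
          positive (suc c) _ = s≤s z≤n

          -- A high vertex has positive degree. So if the pick of j were in `B i` for some other i,
          -- a member of family j would meet `B i`, against `separate`; the pick of i itself is
          -- outside `B i` by choice.
          U∉B : ∀ {i u} → i ∈ is → u ∈ U → u ∉ B i
          U∉B {i} i∈ u∈ u∈B with j , j∈ , refl ← ∈-map⁻ pick u∈ with i ≟ j
          ... | yes refl = proj₁ (high j∈) u∈B
          ... | no i≢j with e , _ , Pe , v∈ ← count-witness (P? j ∧? has? (pick j)) 𝓕 (positive _ (proj₂ (high j∈))) =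
            All.lookup (separate (fromʰ j∈) i∈ (i≢j ∘ sym) Pe) u∈B v∈

          suffix : ∀ (xs : List V) {ys} → Unique (xs ++ ys) → Unique ys
          suffix [] u = u
          suffix (_ ∷ xs) (_ ∷ u) = suffix xs u

          high-size : length highs ≤ suc μ
          high-size = ≤-trans (m≤n+m _ (length lows)) size

          highs-unique : Unique highs
          highs-unique = suffix lows uniq

          -- The measure drops because `pick i` leaves the remainder of every edge through it. The
          -- density is restored by `link-dense`, as at most `μ` other picks are to be avoided.
          links : Tasks d highs B′ P′?
          links = record
            { unique = λ i∈ → All.tabulate (λ u∈ eq → proj₁ (high i∈) (subst (_∈ _) (sym eq) u∈)) ∷ unique (fromʰ i∈)
            ; contains = λ i∈ ((Pe , v∈) , _) → v∈ ∷ contains (fromʰ i∈) Pe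
            ; separate = λ i∈ j∈ i≢j ((Pe , _) , av) →
                All.lookup av (∈-filter⁺ (λ u → ¬? (u ≟ _)) (∈-map⁺ pick j∈) (injective j∈ i∈ (i≢j ∘ sym)))
                ∷ separate (fromʰ i∈) (fromʰ j∈) i≢j Pe
            ; light = λ {i} {e} i∈ e∈ ((Pe , _) , _) → ≤-trans (sumBy-filter X (λ u → ¬? (u ≟ pick i)) (rest (B i) e)) (light (fromʰ i∈) e∈ Pe)
            ; short = λ {i} i∈ e∈ ((Pe , v∈) , _) → ≤-trans
                (filter-notAll (λ u → ¬? (u ≟ pick i)) _ (Any.map (λ eq ¬eq → ¬eq (sym eq)) (∈-rest (B i) v∈ (proj₁ (high i∈)))))
                (≤-pred (short (fromʰ i∈) e∈ Pe))
            ; dense = λ {i} i∈ → link-dense (P? i) (B i) (pick i) (others (pick i) U)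
                (contains (fromʰ i∈)) (unique (fromʰ i∈)) (proj₁ (high i∈))
                (λ u∈ → let u∈U , u≢ = ∈-filter⁻ (λ u → ¬? (u ≟ pick i)) {xs = U} u∈ in u≢ , U∉B (fromʰ i∈) u∈U)
                (length-others (∈-map⁺ pick i∈) (subst (_≤ suc μ) (sym (length-map pick highs)) high-size))
                (proj₂ (high i∈))
            }

          forget : Chosen highs P′ → Chosen highs P
          forget c = let open Chosen c in
            record { edge = edge ; edge∈ = edge∈ ; edge-P = proj₁ ∘ proj₁ ∘ edge-P ; disjoint = disjoint }

          -- The high families are served first, by recursion; then each low family gets an edge
          -- from `candidate`. Since the current low index is neither picked for nor finished, the
          -- picks and the finished indices each number at most `μ`, although there may be `μ` + 1
          -- indices in all.
          grow : Chosen highs P → ∀ ls → (∀ {i} → i ∈ ls → i ∈ lows) → Unique (ls ++ highs) →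
            length ls ≤ length lows → Chosen (ls ++ highs) P
          grow base [] _ _ _ = base
          grow base (i ∷ ls) ⊆lows u@(_ ∷ u′) len′ = attach (candidate B P? T U (ls ++ highs) i i∈
              (Unique-head u)
              (λ j∈ → [ from ∘ ∈-++⁺ˡ ∘ ⊆lows ∘ there , fromʰ ]′ (∈-++⁻ ls j∈))
              (subst (_≤ μ) (sym (length-++ ls)) (≤-pred (≤-trans (+-monoˡ-≤ _ len′) size)))
              (subst (_≤ μ) (sym (length-map pick highs)) (≤-pred (≤-trans (+-monoˡ-≤ (length highs) (≤-trans (s≤s z≤n) len′)) size)))
              (U∉B i∈)
              (low (⊆lows (here refl))) c)
            where
            c = grow base ls (⊆lows ∘ there) u′ (<⇒≤ len′)
            i∈ = from (∈-++⁺ˡ (⊆lows (here refl)))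
            attach : (∃ λ e → e ∈ 𝓕 × P i e × (∀ {j} → j ∈ ls ++ highs → Chosen.edge c j # e)) → Chosen (i ∷ ls ++ highs) P
            attach (e , e∈ , Pe , apart) = add B P? (Unique-head u) e∈ Pe c apart

          reorder : Chosen (lows ++ highs) P → Chosen is P
          reorder c = let open Chosen c in
            record { edge = edge ; edge∈ = edge∈ ∘ into ; edge-P = edge-P ∘ into
                   ; disjoint = λ i∈ j∈ → disjoint (into i∈) (into j∈) }

        -- Induction on the size of the remainders: high families pass to links, where the
        -- remainders are shorter, and low families are handled greedily afterwards.
        rainbow : ∀ d is (B : V → List V) {P : V → E → Set} (P? : ∀ i → Decidable (P i)) →
          Unique is → length is ≤ suc μ → Tasks d is B P? → Chosen is P
        rainbow zero is B P? uis len T = record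
          { edge = const e₀ ; edge∈ = ⊥-elim ∘ none ; edge-P = ⊥-elim ∘ none ; disjoint = λ i∈ → ⊥-elim (none i∈) }
          where
          open Tasks T
          -- A dense family has a member, but no remainder has length below 0. So `is` is empty and
          -- `e₀` is only a filler.
          none : ∀ {i} → i ∈ is → ⊥
          none {i} i∈ with count (P? i) 𝓕 in eq | dense i∈
          ... | zero | ()
          ... | suc _ | _ with e , e∈ , Pe ← count-witness (P? i) 𝓕 (subst (0 <_) (sym eq) (s≤s z≤n)) with () ← short i∈ e∈ Pe
        rainbow (suc d) is B P? uis len T = step (choose B P? is uis)
          where
          step : Choice B P? is → Chosen is _
          step ch = reorder (grow (forget (rainbow d highs B′ P′? highs-unique high-size links)) lows id uniq ≤-refl)
            where open Step B P? uis len T ch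

-- Vertices of large degree and the edges that avoid them

module Structure {V E : Set} (_≟_ : DecidableEquality V) (verts : E → List V) (𝓕 : List E) (X : V → ℕ)
  (vertices : List V) (complete : ∀ v → v ∈ vertices) (vertices! : Unique vertices)
  (L N Xm : ℕ) {{_ : NonZero L}} (X≤Xm : ∀ v → X v ≤ Xm) where

  open DecMem _≟_ using (_∈?_)
  open Hypergraph _≟_ verts 𝓕 X
  open Spread vertices complete L N Xm X≤Xm

  -- Two weight bounds are kept, `Y₀` for edges and `Y` for edges with a vertex removed: with a
  -- single block the links are lighter by the factor (k - 1)/k, and the constants for that case use
  -- this gain.
  module Bounded (spread : ∀ {B} → Unique B → count (contains? B) 𝓕 * scale B ≤ weight B) (e₀ : E)
    (S D s Y Y₀ K : ℕ)
    (edge-size : ∀ {e} → e ∈ 𝓕 → length (verts e) ≤ K)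
    (edge-sum : ∀ {e} → e ∈ 𝓕 → sumBy X (verts e) ≤ Y₀)
    (link-sum : ∀ {v e} → e ∈ 𝓕 → v ∈ verts e → sumBy X (others v (verts e)) ≤ Y)
    (Xm≤Y₀ : Xm ≤ Y₀)
    (Y₀-small : 4 * (s * Y₀) ≤ L)
    (Y-small : (S + D + D) * (s * Y) ≤ S * L)
    (ν≤s : ∀ M → All (_∈ 𝓕) M → AllPairs _#_ M → length M ≤ s) where

    Matching : List E → Set
    Matching M = All (_∈ 𝓕) M × AllPairs _#_ M

    deg-zero : {P : E → Set} (P? : Decidable P) (v : V) → (∀ {e} → P e → v ∉ verts e) → deg P? v ≡ 0
    deg-zero P? v P∌v with deg P? v in eq
    ... | zero = refl
    ... | suc _ with e , _ , Pe , v∈ ← count-witness (P? ∧? has? v) 𝓕 (subst (0 <_) (sym eq) (s≤s z≤n)) =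
      contradiction v∈ (P∌v Pe)

    -- What has to be avoided weighs at most `m * Y₀`, because every edge of `M` weighs at most `Y₀`
    -- and so does every single vertex of `us`.
    greedy : {P : E → Set} (P? : Decidable P) (a b m : ℕ) (us : List V) (M : List E) → All (_∈ 𝓕) M →
      (∀ {u} → u ∈ us ⊎ Any (λ f → u ∈ verts f) M → deg P? u * a ≤ b * X u) →
      length us + length M ≤ m → b * (m * Y₀) < count P? 𝓕 * a →
      ∃ λ e → e ∈ 𝓕 × P e × Avoids us e × All (e #_) M
    greedy {P} P? a b m us M M⊆ small len lt =
      finish (find-avoiding P? a b Z
        (λ u∈ → small ([ inj₁ , inj₂ ∘ ∈-concatMap⁻ verts ]′ (∈-++⁻ us u∈)))
        (≤-<-trans (*-monoʳ-≤ b Z-sum) lt))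
      where
      Z = us ++ concatMap verts M
      Z-sum : sumBy X Z ≤ m * Y₀
      Z-sum = begin
        sumBy X Z                                            ≡⟨ sumBy-++ X us _ ⟩
        sumBy X us + sumBy X (concatMap verts M)             ≤⟨ +-mono-≤ (sumBy-bounded X Y₀ us (λ {v} _ → ≤-trans (X≤Xm v) Xm≤Y₀))
                                                                  (sumBy-concatMap X verts Y₀ M (λ f∈ → edge-sum (All.lookup M⊆ f∈))) ⟩
        length us * Y₀ + length M * Y₀                       ≡⟨ *-distribʳ-+ Y₀ (length us) _ ⟨
        (length us + length M) * Y₀                          ≤⟨ *-monoˡ-≤ Y₀ len ⟩
        m * Y₀                                               ∎
      finish : (∃ λ e → e ∈ 𝓕 × P e × Avoids Z e) → ∃ λ e → e ∈ 𝓕 × P e × Avoids us e × All (e #_) M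
      finish (e , e∈ , Pe , av) = e , e∈ , Pe ,
        All.tabulate (λ u∈ → All.lookup av (∈-++⁺ˡ u∈)) ,
        All.tabulate (λ f∈ v∈e v∈f → All.lookup av (∈-++⁺ʳ us (∈-concatMap⁺ verts (Any.map (λ { refl → v∈f }) f∈))) v∈e)

    -- At most X v X u N / L² edges contain both v and another vertex u; the threshold is this bound
    -- summed over vertices of total weight s Y₀. The shape `L * (L * 1)` is `scale` of a
    -- two-element list.
    Heavy : V → Set
    Heavy v = X v * N * (s * Y₀) < count (has? v) 𝓕 * (L * (L * 1))

    heavy? : Decidable Heavy
    heavy? v = _ <? _

    -- Edges through the heavy vertices are added one at a time. When `v` is served, the waiting
    -- vertices and the edges already present number at most s together, too few to block all edges
    -- through a heavy vertex.
    stars : ∀ vs M → Unique vs → All Heavy vs → Matching M → All (Avoids vs) M → length vs + length M ≤ suc s →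
      ∃ λ M′ → Matching M′ × length M′ ≡ length vs + length M
    stars [] M _ _ mM _ _ = M , mM , refl
    stars (v ∷ vs) M u@(v≢ ∷ u′) (hv ∷ hvs) (M⊆ , M#) av len =
      finish (greedy (has? v) (L * (L * 1)) (X v * N) s vs M M⊆ small (≤-pred len) hv)
      where
      -- Since `M` avoids all of `v ∷ vs`, every vertex to be avoided differs from `v`, and the
      -- bound on edges through two vertices applies.
      ≢v : ∀ {u} → u ∈ vs ⊎ Any (λ f → u ∈ verts f) M → u ≢ v
      ≢v (inj₁ u∈) refl = Unique-head u u∈
      ≢v (inj₂ u∈) refl with f , f∈ , v∈f ← find u∈ = All.lookup (All.lookup av f∈) (here refl) v∈f
      small : ∀ {u} → u ∈ vs ⊎ Any (λ f → u ∈ verts f) M → deg (has? v) u * (L * (L * 1)) ≤ X v * N * X u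
      small {u} u∈ = ≤-trans (deg-spread spread (has? v) (v ∷ []) u (λ v∈ → v∈ ∷ []) ([] ∷ []) (λ { (here eq) → ≢v u∈ eq }))
        (≤-reflexive (*-comm (X u) (X v * N)))
      finish : (∃ λ e → e ∈ 𝓕 × v ∈ verts e × Avoids vs e × All (e #_) M) → ∃ λ M′ → Matching M′ × length M′ ≡ suc (length vs) + length M
      finish (e , e∈ , _ , avs , e#M)
        with M′ , mM′ , eq ← stars vs (e ∷ M) u′ hvs (e∈ ∷ M⊆ , e#M ∷ M#) (avs ∷ All.map All.tail av)
               (≤-trans (≤-reflexive (+-suc _ _)) len) = M′ , mM′ , trans eq (+-suc _ _)

    centres : List V
    centres = filter heavy? vertices

    all-heavy : All Heavy centres
    all-heavy = Allₚ.all-filter heavy? vertices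

    centres! : Unique centres
    centres! = Uniqueₚ.filter⁺ heavy? vertices!

    too-long : ∀ {M} → Matching M → length M ≢ suc s
    too-long (M⊆ , M#) eq = <-irrefl eq (s≤s (ν≤s _ M⊆ M#))

    centres≤s : length centres ≤ s
    centres≤s = ≮⇒≥ λ s<h → contra s<h
      where
      contra : s < length centres → ⊥
      contra s<h with M , mM , eq ← stars (take (suc s) centres) [] (Uniqueₚ.take⁺ (suc s) centres!)
                        (Allₚ.take⁺ (suc s) all-heavy) ([] , []) []
                        (≤-reflexive (trans (+-identityʳ _) (length-take≤ centres s<h))) =
        too-long mM (trans eq (trans (+-identityʳ _) (length-take≤ centres s<h)))

    r : ℕ
    r = s ∸ length centres

    Free : E → Set
    Free = Avoids centres

    free? : Decidable Free
    free? = avoids? centres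

    -- Such a matching misses all centres, so `stars` would extend it by an edge through each centre
    -- to s + 1 disjoint edges.
    no-free-matching : ∀ M → Matching M → All Free M → length M ≢ suc r
    no-free-matching M mM free eq =
      let M′ , mM′ , eq′ = stars centres M centres! all-heavy mM free (≤-reflexive sz) in too-long mM′ (trans eq′ sz)
      where
      sz : length centres + length M ≡ suc s
      sz = trans (cong (length centres +_) eq) (trans (+-suc _ r) (cong suc (m+[n∸m]≡n centres≤s)))

    free-deg : ∀ v → deg free? v * (L * (L * 1)) ≤ N * (s * Y₀) * X v
    free-deg v with v ∈? centres
    ... | yes v∈ = ≤-trans (≤-reflexive (cong (_* (L * (L * 1))) (deg-zero free? v (λ av → All.lookup av v∈)))) z≤n
    ... | no v∉ = begin
      deg free? v * (L * (L * 1))           ≤⟨ *-monoˡ-≤ (L * (L * 1)) (count-mono (free? ∧? has? v) (has? v) 𝓕 (λ _ → proj₂)) ⟩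
      count (has? v) 𝓕 * (L * (L * 1))      ≤⟨ ≮⇒≥ (λ h → v∉ (∈-filter⁺ heavy? (complete v) h)) ⟩
      X v * N * (s * Y₀)                    ≡⟨ lem (X v) N (s * Y₀) ⟩
      N * (s * Y₀) * X v                    ∎
      where
      lem : ∀ x n y → x * n * y ≡ n * y * x
      lem = solve-∀

    module R = Rainbow spread S D r Y
      (≤-trans (*-monoʳ-≤ (S + D + D) (*-monoˡ-≤ Y (m∸n≤m s (length centres)))) Y-small) e₀

    -- The threshold of `High` in the rainbow argument for μ = r and an empty fixed set.
    Dense : V → Set
    Dense v = (S + D + D) * r * Xm * (X v * N) < deg free? v * (L * (L * 1)) * D

    dense? : Decidable Dense
    dense? v = _ <? _

    denseVertices : List V
    denseVertices = filter dense? vertices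

    from-chosen : ∀ {is P} → Unique is → (c : R.Chosen is P) → Matching (map (R.Chosen.edge c) is)
    from-chosen {is} u c = Allₚ.map⁺ (All.tabulate edge∈) , pairs is u id
      where
      open R.Chosen c
      pairs : ∀ js → Unique js → (∀ {j} → j ∈ js → j ∈ is) → AllPairs _#_ (map edge js)
      pairs [] _ _ = []
      pairs (j ∷ js) (j≢ ∷ u) ⊆is =
        Allₚ.map⁺ (All.tabulate (λ k∈ → disjoint (⊆is (here refl)) (⊆is (there k∈)) (All.lookup j≢ k∈)))
        ∷ pairs js u (⊆is ∘ there)

    -- For r + 1 dense vertices, the free edges through one of them that miss the other r form
    -- families to which `rainbow` applies after `link-dense`. The resulting edges would be a free
    -- matching of size r + 1.
    denseVertices≤r : length denseVertices ≤ r
    denseVertices≤r = ≮⇒≥ contra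
      where
      module _ (r<m : r < length denseVertices) where
        is = take (suc r) denseVertices
        is! : Unique is
        is! = Uniqueₚ.take⁺ (suc r) (Uniqueₚ.filter⁺ dense? vertices!)
        |is| : length is ≡ suc r
        |is| = length-take≤ denseVertices r<m
        P : V → E → Set
        P i e = (Free e × i ∈ verts e) × Avoids (others i is) e
        P? : ∀ i → Decidable (P i)
        P? i = (free? ∧? has? i) ∧? avoids? (others i is)
        -- Edges have at most `K` vertices, so `suc K` is a strict bound for the remainders.
        tasks : R.Tasks (suc K) is [_] P?
        tasks = record
          { unique = λ _ → [] ∷ []
          ; contains = λ _ ((_ , i∈e) , _) → i∈e ∷ []
          ; separate = λ {i} _ j∈ i≢j (_ , av) → All.lookup av (∈-filter⁺ (λ u → ¬? (u ≟ i)) j∈ (i≢j ∘ sym)) ∷ []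
          ; light = λ _ e∈ ((_ , i∈e) , _) → link-sum e∈ i∈e
          ; short = λ {i} {e} _ e∈ _ → s≤s (≤-trans (length-filter (λ u → ¬? (u ≟ i)) (verts e)) (edge-size e∈))
          ; dense = λ {i} i∈ → Levels.link-dense spread S D r free? [] i (others i is) (λ _ → []) [] (λ ())
              (λ u∈ → proj₂ (∈-filter⁻ (λ u → ¬? (u ≟ i)) {xs = is} u∈) , λ ())
              (length-others i∈ (≤-reflexive |is|))
              (proj₂ (∈-filter⁻ dense? {xs = vertices} (∈-take (suc r) i∈)))
          }
        conclude : R.Chosen is P → ⊥
        conclude c = no-free-matching (map edge is) (from-chosen is! c)
          (Allₚ.map⁺ (All.tabulate (proj₁ ∘ proj₁ ∘ edge-P))) (trans (length-map edge is) |is|)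
          where open R.Chosen c
        contra : ⊥
        contra = conclude (R.rainbow (suc K) is [_] P? is! (≤-reflexive |is|) tasks)

    Sparse : E → Set
    Sparse e = Free e × Avoids denseVertices e

    sparse? : Decidable Sparse
    sparse? = free? ∧? avoids? denseVertices

    sparse-deg : ∀ v → deg sparse? v * (L * (L * 1) * D) ≤ (S + D + D) * r * Xm * N * X v
    sparse-deg v = cases (v ∈? denseVertices)
      where
      lem : ∀ y x n → y * (x * n) ≡ y * n * x
      lem = solve-∀
      cases : Dec (v ∈ denseVertices) → deg sparse? v * (L * (L * 1) * D) ≤ (S + D + D) * r * Xm * N * X v
      cases (yes v∈) = ≤-trans (≤-reflexive (cong (_* (L * (L * 1) * D)) (deg-zero sparse? v (λ (_ , av) → All.lookup av v∈)))) z≤n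
      cases (no v∉) = begin
        deg sparse? v * (L * (L * 1) * D)        ≤⟨ *-monoˡ-≤ (L * (L * 1) * D) (count-mono (sparse? ∧? has? v) (free? ∧? has? v) 𝓕 (λ _ ((f , _) , v∈) → f , v∈)) ⟩
        deg free? v * (L * (L * 1) * D)          ≡⟨ *-assoc (deg free? v) (L * (L * 1)) D ⟨
        deg free? v * (L * (L * 1)) * D          ≤⟨ ≮⇒≥ (λ h → v∉ (∈-filter⁺ dense? (complete v) h)) ⟩
        (S + D + D) * r * Xm * (X v * N)         ≡⟨ lem ((S + D + D) * r * Xm) (X v) N ⟩
        (S + D + D) * r * Xm * N * X v           ∎

    -- With all degrees below the second threshold, any larger number of sparse edges would let the
    -- greedy choice continue until r + 1 disjoint free edges are found.
    sparse-few : count sparse? 𝓕 * (L * (L * 1) * D) ≤ (S + D + D) * r * Xm * N * (r * Y₀)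
    sparse-few = ≮⇒≥ λ lt → let M , mM , free , eq = build lt (suc r) ≤-refl in no-free-matching M mM free eq
      where
      module _ (lt : (S + D + D) * r * Xm * N * (r * Y₀) < count sparse? 𝓕 * (L * (L * 1) * D)) where
        build : ∀ j → j ≤ suc r → ∃ λ M → Matching M × All Free M × length M ≡ j
        build zero _ = [] , ([] , []) , [] , refl
        build (suc j) j<r with M , (M⊆ , M#) , free , eq ← build j (<⇒≤ j<r) = finish
          (greedy sparse? (L * (L * 1) * D) ((S + D + D) * r * Xm * N) r [] M M⊆ (λ {u} _ → sparse-deg u)
            (≤-trans (≤-reflexive eq) (≤-pred j<r)) lt)
          where
          finish : (∃ λ e → e ∈ 𝓕 × Sparse e × Avoids [] e × All (e #_) M) → ∃ λ M → Matching M × All Free M × length M ≡ suc j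
          finish (e , e∈ , (f , _) , _ , e#) = e ∷ M , (e∈ ∷ M⊆ , e# ∷ M#) , f ∷ free , cong suc eq

    -- A free edge is sparse or lies in one of at most r stars of dense vertices, whose degrees are
    -- limited by `free-deg`. Both contributions carry a factor s Y₀ / L, for the sparse edges
    -- because r ≤ s, and `Y₀-small` makes it 1/4; the coefficients S + 2D and D add up to S + 3D.
    free-few : 4 * (count free? 𝓕 * L * D) ≤ (S + D + D + D) * (r * Xm * N)
    free-few = *-cancelʳ-≤ _ _ L (begin
      4 * (c * L * D) * L
        ≡⟨ lem₁ c L D ⟩
      4 * (c * (L * (L * 1)) * D)
        ≤⟨ *-monoʳ-≤ 4 (*-monoˡ-≤ D (≤-trans (count-avoid free? (L * (L * 1)) (N * (s * Y₀)) denseVertices (λ {v} _ → free-deg v))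
             (+-monoʳ-≤ _ (*-monoʳ-≤ (N * (s * Y₀)) (≤-trans (sumBy-bounded X Xm denseVertices (λ {v} _ → X≤Xm v)) (*-monoˡ-≤ Xm denseVertices≤r)))))) ⟩
      4 * ((c′ * (L * (L * 1)) + N * (s * Y₀) * (r * Xm)) * D)
        ≡⟨ lem₂ c′ (L * (L * 1)) (N * (s * Y₀) * (r * Xm)) D ⟩
      4 * (c′ * (L * (L * 1) * D) + N * (s * Y₀) * (r * Xm) * D)
        ≤⟨ *-monoʳ-≤ 4 (+-monoˡ-≤ _ (≤-trans sparse-few (*-monoʳ-≤ ((S + D + D) * r * Xm * N) (*-monoˡ-≤ Y₀ (m∸n≤m s (length centres)))))) ⟩
      4 * ((S + D + D) * r * Xm * N * (s * Y₀) + N * (s * Y₀) * (r * Xm) * D)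
        ≡⟨ lem₃ (S + D + D) D r Xm N (s * Y₀) ⟩
      (S + D + D + D) * (r * Xm * N) * (4 * (s * Y₀))
        ≤⟨ *-monoʳ-≤ ((S + D + D + D) * (r * Xm * N)) Y₀-small ⟩
      (S + D + D + D) * (r * Xm * N) * L ∎)
      where
      c = count free? 𝓕
      c′ = count sparse? 𝓕
      lem₁ : ∀ c L D → 4 * (c * L * D) * L ≡ 4 * (c * (L * (L * 1)) * D)
      lem₁ = solve-∀
      lem₂ : ∀ c a y D → 4 * ((c * a + y) * D) ≡ 4 * (c * (a * D) + y * D)
      lem₂ = solve-∀
      lem₃ : ∀ G D r x n y → 4 * (G * r * x * n * y + n * y * (r * x) * D) ≡ (G + D) * (r * x * n) * (4 * y)
      lem₃ = solve-∀

    few-avoid-centres : ∃ λ H → Unique H × length H ≤ s ×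
      4 * (count (avoids? H) 𝓕 * L * D) ≤ (S + D + D + D) * ((s ∸ length H) * Xm * N)
    few-avoid-centres = centres , centres! , centres≤s , free-few

-- Binomial coefficients and enumeration of direct products

-- Both sides count the (k + 1)-subsets of n + 1 points with a marked element; the proof is an
-- induction along Pascal's rule.
absorption : ∀ n k → suc k * (suc n C suc k) ≡ suc n * (n C k)
absorption zero zero = refl
absorption zero (suc k) = trans (cong (suc (suc k) *_) (k>n⇒nCk≡0 {suc zero} {suc (suc k)} (s≤s (s≤s z≤n)))) (*-zeroʳ (suc (suc k)))
absorption (suc n) zero = trans (*-identityˡ _) (trans (nC1≡n (suc (suc n))) (sym (*-identityʳ _)))
absorption (suc n) (suc k) = begin-equality
  suc (suc k) * (suc (suc n) C suc (suc k))                ≡⟨ cong (suc (suc k) *_) (nCk+nC[k+1]≡[n+1]C[k+1] (suc n) (suc k)) ⟨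
  suc (suc k) * (c + (suc n C suc (suc k)))                ≡⟨ *-distribˡ-+ (suc (suc k)) c _ ⟩
  c + suc k * c + suc (suc k) * (suc n C suc (suc k))      ≡⟨ cong₂ (λ x y → c + x + y) (absorption n k) (absorption n (suc k)) ⟩
  c + suc n * (n C k) + suc n * (n C suc k)                ≡⟨ +-assoc c _ _ ⟩
  c + (suc n * (n C k) + suc n * (n C suc k))              ≡⟨ cong (c +_) (*-distribˡ-+ (suc n) (n C k) _) ⟨
  c + suc n * ((n C k) + (n C suc k))                      ≡⟨ cong (λ x → c + suc n * x) (nCk+nC[k+1]≡[n+1]C[k+1] n k) ⟩
  c + suc n * c                                            ∎
  where c = suc n C suc k

-- The number of k-subsets of a set with f free elements and b further elements that must be taken.
ways : ℕ → ℕ → ℕ → ℕ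
ways zero f k = f C k
ways (suc b) f zero = 0
ways (suc b) f (suc k) = ways b f k

ways-pascal₀ : ∀ b f → ways b (suc f) 0 ≡ ways b f 0
ways-pascal₀ zero f = refl
ways-pascal₀ (suc b) f = refl

ways-pascal : ∀ b f k → ways b (suc f) (suc k) ≡ ways b f (suc k) + ways b f k
ways-pascal zero f k = trans (sym (nCk+nC[k+1]≡[n+1]C[k+1] f k)) (+-comm (f C k) _)
ways-pascal (suc b) f zero = trans (ways-pascal₀ b f) (sym (+-identityʳ _))
ways-pascal (suc b) f (suc k) = ways-pascal b f k

ways-mono : ∀ b f k → ways (suc b) f k ≤ ways b (suc f) k
ways-mono b f zero = z≤n
ways-mono b f (suc k) = ≤-trans (m≤n+m _ (ways b f (suc k))) (≤-reflexive (sym (ways-pascal b f k)))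

-- Demanding one more element keeps a proportion of at most k / (b + f + 1) of the sets. For b = 0
-- this is `absorption`; each further required element adds 1 to numerator and denominator, which is
-- harmless since by `ways-mono` the proportion is at most 1.
ways-ratio : ∀ b f k → ways (suc b) f k * suc (b + f) ≤ ways b (suc f) k * k
ways-ratio b f zero = z≤n
ways-ratio zero f (suc k) = ≤-reflexive (trans (*-comm (f C k) _) (trans (sym (absorption f k)) (*-comm (suc k) _)))
ways-ratio (suc b) f (suc k) = begin
  w * suc (suc (b + f))                              ≡⟨ *-suc w _ ⟩
  w + w * suc (b + f)                                ≤⟨ +-mono-≤ (ways-mono b f k) (ways-ratio b f k) ⟩
  ways b (suc f) k + ways b (suc f) k * k            ≡⟨ *-suc (ways b (suc f) k) k ⟨
  ways b (suc f) k * suc k                           ∎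
  where w = ways (suc b) f k

-- Enumeration of subsets with prescribed elements

open Vec using ([]; _∷_)

-- One enumeration serves two counts: `required` describes the supersets of a given set, `forbidden`
-- the sets that avoid it.
data Mark : Set where
  required forbidden free : Mark

isRequired isFree : Mark → ℕ
isRequired required = 1
isRequired forbidden = 0
isRequired free = 0
isFree required = 0
isFree forbidden = 0
isFree free = 1

_fits_ : Side → Mark → Set
s fits required = s ≡ inside
s fits forbidden = s ≡ outside
s fits free = ⊤

total : ∀ {n} → (Fin n → ℕ) → ℕ
total f = sum (tabulate f)

with-inside : ∀ {n} → (ℕ → List (Subset n)) → ℕ → List (Subset (suc n))
with-inside xs zero = []
with-inside xs (suc k) = map (inside ∷_) (xs k)

prepend : ∀ {n} → Mark → (ℕ → List (Subset n)) → ℕ → List (Subset (suc n))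
prepend required xs k = with-inside xs k
prepend forbidden xs k = map (outside ∷_) (xs k)
prepend free xs k = map (outside ∷_) (xs k) ++ with-inside xs k

enumerate : ∀ {n} → (Fin n → Mark) → ℕ → List (Subset n)
enumerate {zero} c zero = [] ∷ []
enumerate {zero} c (suc k) = []
enumerate {suc n} c k = prepend (c zero) (enumerate (c ∘ suc)) k

length-enumerate : ∀ {n} (c : Fin n → Mark) k →
  length (enumerate c k) ≡ ways (total (isRequired ∘ c)) (total (isFree ∘ c)) k
length-enumerate {zero} c zero = refl
length-enumerate {zero} c (suc k) = sym (k>n⇒nCk≡0 {0} {suc k} (s≤s z≤n))
length-enumerate {suc n} c k with c zero
length-enumerate {suc n} c zero | required = refl
length-enumerate {suc n} c (suc k) | required = trans (length-map (inside ∷_) (enumerate (c ∘ suc) k)) (length-enumerate (c ∘ suc) k)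
... | forbidden = trans (length-map (outside ∷_) (enumerate (c ∘ suc) k)) (length-enumerate (c ∘ suc) k)
length-enumerate {suc n} c zero | free = trans (cong length (++-identityʳ (map (outside ∷_) (enumerate (c ∘ suc) 0))))
  (trans (length-map (outside ∷_) (enumerate (c ∘ suc) 0)) (trans (length-enumerate (c ∘ suc) 0) (sym (ways-pascal₀ (total (isRequired ∘ c ∘ suc)) _))))
length-enumerate {suc n} c (suc k) | free = trans (length-++ (map (outside ∷_) (enumerate (c ∘ suc) (suc k))))
  (trans (cong₂ _+_ (trans (length-map (outside ∷_) (enumerate (c ∘ suc) (suc k))) (length-enumerate (c ∘ suc) (suc k))) (trans (length-map (inside ∷_) (enumerate (c ∘ suc) k)) (length-enumerate (c ∘ suc) k)))
    (sym (ways-pascal (total (isRequired ∘ c ∘ suc)) _ k)))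

∈-with-inside : ∀ {n} (xs : ℕ → List (Subset n)) k {S} → S ∈ with-inside xs k → Vec.head S ≡ inside
∈-with-inside xs (suc k) S∈ with _ , _ , refl ← ∈-map⁻ (inside ∷_) S∈ = refl

with-inside! : ∀ {n} (xs : ℕ → List (Subset n)) → (∀ k → Unique (xs k)) → ∀ k → Unique (with-inside xs k)
with-inside! xs u zero = []
with-inside! xs u (suc k) = Uniqueₚ.map⁺ Vecₚ.∷-injectiveʳ (u k)

enumerate! : ∀ {n} (c : Fin n → Mark) k → Unique (enumerate c k)
enumerate! {zero} c zero = [] ∷ []
enumerate! {zero} c (suc k) = []
enumerate! {suc n} c k with c zero
... | required = with-inside! _ (enumerate! (c ∘ suc)) k
... | forbidden = Uniqueₚ.map⁺ Vecₚ.∷-injectiveʳ (enumerate! (c ∘ suc) k)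
... | free = Uniqueₚ.++⁺ (Uniqueₚ.map⁺ Vecₚ.∷-injectiveʳ (enumerate! (c ∘ suc) k)) (with-inside! _ (enumerate! (c ∘ suc)) k) disj
  where
  disj : ∀ {S} → ¬ (S ∈ map (outside ∷_) (enumerate (c ∘ suc) k) × S ∈ with-inside (enumerate (c ∘ suc)) k)
  disj (S∈ , S∈′) with _ , _ , refl ← ∈-map⁻ (outside ∷_) S∈ with () ← ∈-with-inside (enumerate (c ∘ suc)) k S∈′

enumerate-complete : ∀ {n} (c : Fin n → Mark) (S : Subset n) → (∀ x → Vec.lookup S x fits c x) → S ∈ enumerate c ∣ S ∣
enumerate-complete c [] _ = here refl
enumerate-complete c (s ∷ S) fit with c zero | fit zero | enumerate-complete (c ∘ suc) S (fit ∘ suc)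
... | required | refl | S∈ = ∈-map⁺ (inside ∷_) S∈
... | forbidden | refl | S∈ = ∈-map⁺ (outside ∷_) S∈
enumerate-complete c (true ∷ S) fit | free | _ | S∈ = ∈-++⁺ʳ (map (outside ∷_) (enumerate (c ∘ suc) (suc ∣ S ∣))) (∈-map⁺ (inside ∷_) S∈)
enumerate-complete c (false ∷ S) fit | free | _ | S∈ = ∈-++⁺ˡ (∈-map⁺ (outside ∷_) S∈)

enumerate-sound : ∀ {n} (c : Fin n → Mark) k {S} → S ∈ enumerate c k → ∀ x → Vec.lookup S x fits c x
enumerate-sound {suc n} c k S∈ x with c zero in eq
enumerate-sound {suc n} c (suc k) S∈ zero | required with _ , _ , refl ← ∈-map⁻ (inside ∷_) S∈ rewrite eq = refl
enumerate-sound {suc n} c (suc k) S∈ (suc x) | required with _ , S∈′ , refl ← ∈-map⁻ (inside ∷_) S∈ = enumerate-sound (c ∘ suc) k S∈′ x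
enumerate-sound {suc n} c k S∈ zero | forbidden with _ , _ , refl ← ∈-map⁻ (outside ∷_) S∈ rewrite eq = refl
enumerate-sound {suc n} c k S∈ (suc x) | forbidden with _ , S∈′ , refl ← ∈-map⁻ (outside ∷_) S∈ = enumerate-sound (c ∘ suc) k S∈′ x
enumerate-sound {suc n} c k S∈ zero | free rewrite eq = tt
enumerate-sound {suc n} c k S∈ (suc x) | free with ∈-++⁻ (map (outside ∷_) (enumerate (c ∘ suc) k)) S∈
... | inj₁ S∈₁ with _ , S∈′ , refl ← ∈-map⁻ (outside ∷_) S∈₁ = enumerate-sound (c ∘ suc) k S∈′ x
enumerate-sound {suc n} c (suc k) S∈ (suc x) | free | inj₂ S∈₂ with _ , S∈′ , refl ← ∈-map⁻ (inside ∷_) S∈₂ = enumerate-sound (c ∘ suc) k S∈′ x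

-- Direct products of families of subsets

prod : ∀ {n} → (Fin n → ℕ) → ℕ
prod f = product (tabulate f)

consG : ∀ {ℓ} {n : Fin (suc ℓ) → ℕ} → Subset (n zero) → GSet ℓ (n ∘ suc) → GSet (suc ℓ) n
consG S F zero = S
consG S F (suc i) = F i

pairs : ∀ {ℓ} {n : Fin (suc ℓ) → ℕ} → List (Subset (n zero)) → List (GSet ℓ (n ∘ suc)) → List (GSet (suc ℓ) n)
pairs {ℓ} {n} xs Gs = concatMap (λ S → map (consG {ℓ} {n} S) Gs) xs

sections : ∀ {ℓ} {n : Fin ℓ → ℕ} → (∀ i → List (Subset (n i))) → List (GSet ℓ n)
sections {zero} A = (λ ()) ∷ []
sections {suc ℓ} {n} A = pairs {n = n} (A zero) (sections (λ i → A (suc i)))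

length-pairs : ∀ {ℓ} {n : Fin (suc ℓ) → ℕ} (xs : List (Subset (n zero))) (Gs : List (GSet ℓ (n ∘ suc))) →
  length (pairs {n = n} xs Gs) ≡ length xs * length Gs
length-pairs [] Gs = refl
length-pairs {ℓ} {n} (S ∷ xs) Gs = trans (length-++ (map (consG {ℓ} {n} S) Gs))
  (cong₂ _+_ (length-map (consG {ℓ} {n} S) Gs) (length-pairs {n = n} xs Gs))

length-sections : ∀ {ℓ} {n : Fin ℓ → ℕ} (A : ∀ i → List (Subset (n i))) → length (sections A) ≡ prod (λ i → length (A i))
length-sections {zero} A = refl
length-sections {suc ℓ} {n} A = trans (length-pairs {n = n} (A zero) (sections (λ i → A (suc i))))
  (cong (length (A zero) *_) (length-sections (λ i → A (suc i))))

sections-complete : ∀ {ℓ} {n : Fin ℓ → ℕ} (A : ∀ i → List (Subset (n i))) (F : GSet ℓ n) →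
  (∀ i → F i ∈ A i) → Any (λ G → ∀ i → F i ≡ G i) (sections A)
sections-complete {zero} A F _ = here λ ()
sections-complete {suc ℓ} {n} A F F∈ = Anyₚ.concatMap⁺ (λ S → map (consG {ℓ} {n} S) (sections (λ i → A (suc i))))
  (Any.map (λ { refl → Anyₚ.map⁺ (Any.map (λ eq → λ { zero → refl ; (suc i) → eq i })
    (sections-complete (λ i → A (suc i)) (λ i → F (suc i)) (λ i → F∈ (suc i)))) }) (F∈ zero))

sections-sound : ∀ {ℓ} {n : Fin ℓ → ℕ} (A : ∀ i → List (Subset (n i))) {F : GSet ℓ n} → F ∈ sections A → ∀ i → F i ∈ A i
sections-sound {suc ℓ} {n} A F∈ i
  with S , S∈ , F∈′ ← find (∈-concatMap⁻ (λ S → map (consG {ℓ} {n} S) (sections (λ i → A (suc i)))) {xs = A zero} F∈)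
  with _ , G∈ , refl ← ∈-map⁻ (consG {ℓ} {n} S) F∈′ with i
... | zero = S∈
... | suc j = sections-sound (λ i → A (suc i)) G∈ j

pairs-distinct : ∀ {ℓ} {n : Fin (suc ℓ) → ℕ} (xs : List (Subset (n zero))) (Gs : List (GSet ℓ (n ∘ suc))) →
  Unique xs → IsFamily Gs → IsFamily (pairs {n = n} xs Gs)
pairs-distinct [] Gs _ _ = []
pairs-distinct {ℓ} {n} (S ∷ xs) Gs (S≢ ∷ u) d = AllPairsₚ.++⁺
  (AllPairsₚ.map⁺ (AllPairs.map (λ d eq → d (λ i → eq (suc i))) d))
  (pairs-distinct {n = n} xs Gs u d)
  (Allₚ.map⁺ (All.tabulate λ {F} F∈ → Allₚ.concat⁺ (Allₚ.map⁺ (All.tabulate λ T∈ →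
    Allₚ.map⁺ (All.tabulate λ {G} G∈ eq → All.lookup S≢ T∈ (eq zero))))))

sections-distinct : ∀ {ℓ} {n : Fin ℓ → ℕ} (A : ∀ i → List (Subset (n i))) → (∀ i → Unique (A i)) → IsFamily (sections A)
sections-distinct {zero} A _ = [] ∷ []
sections-distinct {suc ℓ} {n} A A! = pairs-distinct {n = n} (A zero) _ (A! zero) (sections-distinct (λ i → A (suc i)) (λ i → A! (suc i)))

remove : {A : Set} {P : A → Set} (xs : List A) → Any P xs → List A
remove (x ∷ xs) (here _) = xs
remove (x ∷ xs) (there p) = x ∷ remove xs p

length-remove : {A : Set} {P : A → Set} (xs : List A) (p : Any P xs) → length xs ≡ suc (length (remove xs p))
length-remove (x ∷ xs) (here _) = refl
length-remove (x ∷ xs) (there p) = cong suc (length-remove xs p)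

remove-other : {A : Set} {P Q : A → Set} (xs : List A) (p : Any P xs) → (∀ {x} → P x → ¬ Q x) → Any Q xs → Any Q (remove xs p)
remove-other (x ∷ xs) (here px) ¬q (here qx) = contradiction qx (¬q px)
remove-other (x ∷ xs) (here px) ¬q (there q) = q
remove-other (x ∷ xs) (there p) ¬q (here qx) = here qx
remove-other (x ∷ xs) (there p) ¬q (there q) = there (remove-other xs p ¬q q)

-- The partner of each x is removed from `ys`, and no later element of `xs` can have used it. A
-- relation takes the place of equality because members of the product are functions and are
-- compared block by block.
pigeonhole : {A B : Set} (_~_ : A → B → Set) (xs : List A) (ys : List B) →
  AllPairs (λ x x′ → ∀ {y} → x ~ y → ¬ (x′ ~ y)) xs → All (λ x → Any (x ~_) ys) xs → length xs ≤ length ys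
pigeonhole _~_ [] ys _ _ = z≤n
pigeonhole _~_ (x ∷ xs) ys (x# ∷ xs#) (p ∷ ps) = subst (suc (length xs) ≤_) (sym (length-remove ys p))
  (s≤s (pigeonhole _~_ xs (remove ys p) xs# (All.zipWith {P = λ x′ → ∀ {y} → x ~ y → ¬ (x′ ~ y)} (λ (x#x′ , q) → remove-other ys p x#x′ q) (x# , ps))))

family-≤ : ∀ {ℓ} {n : Fin ℓ → ℕ} (A : ∀ i → List (Subset (n i))) (𝓖 : List (GSet ℓ n)) → IsFamily 𝓖 →
  (∀ {F} → F ∈ 𝓖 → ∀ i → F i ∈ A i) → length 𝓖 ≤ prod (length ∘ A)
family-≤ A 𝓖 d 𝓖⊆ = subst (length 𝓖 ≤_) (length-sections A)
  (pigeonhole (λ F G → ∀ i → F i ≡ G i) 𝓖 (sections A)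
    (AllPairs.map (λ d {G} F≡ F′≡ → d (λ i → trans (F≡ i) (sym (F′≡ i)))) d)
    (All.tabulate (λ {F} F∈ → sections-complete A F (𝓖⊆ F∈))))

module _ {ℓ : ℕ} (i : Fin ℓ) where

  private
    ≢i? : ∀ j → Dec (¬ (j ≡ i))
    ≢i? j = ¬? (j Fin.≟ i)

  -- Both cases go through the induction together: after the single occurrence of `i` the filter
  -- drops nothing more.
  product-except : (f : Fin ℓ → ℕ) (is : List (Fin ℓ)) → Unique is →
    (i ∈ is → product (map f is) ≡ f i * product (map f (filter ≢i? is))) ×
    (i ∉ is → product (map f is) ≡ product (map f (filter ≢i? is)))
  product-except f [] _ = (λ ()) , λ _ → refl
  product-except f (j ∷ is) u@(_ ∷ u′) with j Fin.≟ i | product-except f is u′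
  ... | yes refl | _ , out = (λ _ → cong (f i *_) (out (Unique-head u))) , λ i∉ → contradiction (here refl) i∉
  ... | no j≢i | inn , out =
    (λ { (here eq) → contradiction (sym eq) j≢i
       ; (there i∈) → trans (cong (f j *_) (inn i∈)) (swap (f j) (f i) _) }) ,
    λ i∉ → cong (f j *_) (out (i∉ ∘ there))
    where
    swap : ∀ a b c → a * (b * c) ≡ b * (a * c)
    swap = solve-∀

  prod-split : (f : Fin ℓ → ℕ) → prod f ≡ f i * prodExcept ℓ i f
  prod-split f = trans (cong product (sym (map-tabulate id f)))
    (proj₁ (product-except f (allFin ℓ) (Uniqueₚ.allFin⁺ ℓ)) (∈-allFin i))

  prodExcept-cong : {f g : Fin ℓ → ℕ} → (∀ j → j ≢ i → f j ≡ g j) → prodExcept ℓ i f ≡ prodExcept ℓ i g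
  prodExcept-cong f≡g = cong product (map-cong-local (All.map (λ {j} → f≡g j) (Allₚ.all-filter ≢i? (allFin ℓ))))

-- Finite products, sums and maxima

prod-mono : ∀ {ℓ} {f g : Fin ℓ → ℕ} → (∀ i → f i ≤ g i) → prod f ≤ prod g
prod-mono {zero} _ = ≤-refl
prod-mono {suc ℓ} f≤g = *-mono-≤ (f≤g zero) (prod-mono (f≤g ∘ suc))

prod-cong : ∀ {ℓ} {f g : Fin ℓ → ℕ} → (∀ i → f i ≡ g i) → prod f ≡ prod g
prod-cong {zero} _ = refl
prod-cong {suc ℓ} f≡g = cong₂ _*_ (f≡g zero) (prod-cong (f≡g ∘ suc))

prod-positive : ∀ {ℓ} {f : Fin ℓ → ℕ} → (∀ i → 1 ≤ f i) → 1 ≤ prod f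
prod-positive {zero} _ = ≤-refl
prod-positive {suc ℓ} pos = *-mono-≤ (pos zero) (prod-positive (pos ∘ suc))

total-mono : ∀ {ℓ} {f g : Fin ℓ → ℕ} → (∀ i → f i ≤ g i) → total f ≤ total g
total-mono {zero} _ = ≤-refl
total-mono {suc ℓ} f≤g = +-mono-≤ (f≤g zero) (total-mono (f≤g ∘ suc))

total-cong : ∀ {ℓ} {f g : Fin ℓ → ℕ} → (∀ i → f i ≡ g i) → total f ≡ total g
total-cong {zero} _ = refl
total-cong {suc ℓ} f≡g = cong₂ _+_ (f≡g zero) (total-cong (f≡g ∘ suc))

total-+ : ∀ {ℓ} (f g : Fin ℓ → ℕ) → total (λ i → f i + g i) ≡ total f + total g
total-+ {zero} f g = refl
total-+ {suc ℓ} f g = trans (cong (f zero + g zero +_) (total-+ (f ∘ suc) (g ∘ suc))) (lem (f zero) (g zero) _ _)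
  where
  lem : ∀ a b c d → a + b + (c + d) ≡ a + c + (b + d)
  lem = solve-∀

total-* : ∀ {ℓ} a (f : Fin ℓ → ℕ) → total (λ i → a * f i) ≡ a * total f
total-* {zero} a f = sym (*-zeroʳ a)
total-* {suc ℓ} a f = trans (cong (a * f zero +_) (total-* a (f ∘ suc))) (sym (*-distribˡ-+ a (f zero) _))

total-const : ∀ ℓ c → total {ℓ} (λ _ → c) ≡ ℓ * c
total-const zero c = refl
total-const (suc ℓ) c = cong (c +_) (total-const ℓ c)

total-zero : ∀ {ℓ} → total {ℓ} (λ _ → 0) ≡ 0
total-zero {ℓ} = trans (total-const ℓ 0) (*-zeroʳ ℓ)

≤-sum : ∀ {ℓ} (f : Fin ℓ → ℕ) i → f i ≤ total f
≤-sum f zero = m≤m+n _ _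
≤-sum f (suc i) = ≤-trans (≤-sum (f ∘ suc) i) (m≤n+m _ (f zero))

argmax : ∀ {ℓ} (f : Fin (suc ℓ) → ℕ) → ∃ λ i → ∀ j → f j ≤ f i
argmax {zero} f = zero , λ { zero → ≤-refl }
argmax {suc ℓ} f with argmax (f ∘ suc)
... | i , max with ≤-total (f zero) (f (suc i))
... | inj₁ f0≤ = suc i , λ { zero → f0≤ ; (suc j) → max j }
... | inj₂ fi≤ = zero , λ { zero → ≤-refl ; (suc j) → ≤-trans (max j) fi≤ }

≤-maxFin : ∀ {ℓ} (f : Fin ℓ → ℕ) i → f i ≤ maxFin ℓ f
≤-maxFin {ℓ} f i = go (allFin ℓ) (∈-allFin i)
  where
  go : ∀ is → i ∈ is → f i ≤ foldr _⊔_ 0 (map f is)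
  go (_ ∷ is) (here refl) = m≤m⊔n (f i) _
  go (j ∷ is) (there i∈) = ≤-trans (go is i∈) (m≤n⊔m (f j) _)

-- Binomial coefficients when points are removed

C-monoˡ : ∀ {m n} k → m ≤ n → m C k ≤ n C k
C-monoˡ {m} k m≤n with d , refl ← m≤n⇒∃[o]m+o≡n m≤n = go d k
  where
  step : ∀ j k → j C k ≤ suc j C k
  step j zero = ≤-refl
  step j (suc k) = ≤-trans (m≤n+m _ (j C k)) (≤-reflexive (nCk+nC[k+1]≡[n+1]C[k+1] j k))
  go : ∀ d k → m C k ≤ (m + d) C k
  go zero k = ≤-reflexive (cong (_C k) (sym (+-identityʳ m)))
  go (suc d) k = ≤-trans (go d k) (≤-trans (step (m + d) k) (≤-reflexive (cong (_C k) (sym (+-suc m d)))))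

-- Of the k-subsets of m + 1 points, a proportion k / (m + 1) contains a given point, and the others
-- are the k-subsets of m points.
C-drop : ∀ m k → suc m * (m C k) + k * (suc m C k) ≡ suc m * (suc m C k)
C-drop m zero = +-identityʳ _
C-drop m (suc k) = begin-equality
  suc m * (m C suc k) + suc k * (suc m C suc k)      ≡⟨ cong (suc m * (m C suc k) +_) (absorption m k) ⟩
  suc m * (m C suc k) + suc m * (m C k)              ≡⟨ *-distribˡ-+ (suc m) (m C suc k) _ ⟨
  suc m * ((m C suc k) + (m C k))                    ≡⟨ cong (suc m *_) (trans (+-comm (m C suc k) _) (nCk+nC[k+1]≡[n+1]C[k+1] m k)) ⟩
  suc m * (suc m C suc k)                            ∎

C-drop∸ : ∀ m k → suc m * (m C k) ≡ (suc m ∸ k) * (suc m C k)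
C-drop∸ m k = begin-equality
  suc m * (m C k)                                                    ≡⟨ m+n∸n≡m _ (k * (suc m C k)) ⟨
  suc m * (m C k) + k * (suc m C k) ∸ k * (suc m C k)                ≡⟨ cong (_∸ k * (suc m C k)) (C-drop m k) ⟩
  suc m * (suc m C k) ∸ k * (suc m C k)                              ≡⟨ *-distribʳ-∸ (suc m C k) (suc m) k ⟨
  (suc m ∸ k) * (suc m C k)                                          ∎

∸-suc< : ∀ {n t} → t < n → n ∸ t ≡ suc (n ∸ suc t)
∸-suc< {suc n} {zero} _ = refl
∸-suc< {suc n} {suc t} (s≤s t<n) = ∸-suc< t<n

-- The ratio C(n-t-1,k) / C(n-t,k) = 1 - k/(n-t) decreases with t, so removing points one at a time
-- from two blocks is at least as harmful when all of them come from the block with the smaller ratio.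
module _ (n k n′ k′ b : ℕ) where

  shift-all : ∀ a → k * (n′ ∸ b) ≤ k′ * (n ∸ a) → a ≤ n → b + a ≤ n′ →
    (n C k) * ((n′ ∸ (b + a)) C k′) ≤ ((n ∸ a) C k) * ((n′ ∸ b) C k′)
  shift-all zero _ _ _ = ≤-reflexive (cong (λ x → (n C k) * ((n′ ∸ x) C k′)) (+-identityʳ b))
  -- With the denominators of both ratios cleared, the induction hypothesis is multiplied by the
  -- comparison `ratios` of moving one more point.
  shift-all (suc a) ratio a<n b+a<n′ = *-cancelˡ-≤ (suc m * suc m′) (begin
    suc m * suc m′ * (c₀ * ((n′ ∸ (b + suc a)) C k′))      ≡⟨ cong (λ x → suc m * suc m′ * (c₀ * ((n′ ∸ x) C k′))) (+-suc b a) ⟩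
    suc m * suc m′ * (c₀ * (m′ C k′))                      ≡⟨ lem₁ (suc m) (suc m′) c₀ _ ⟩
    suc m * c₀ * (suc m′ * (m′ C k′))                      ≡⟨ cong (suc m * c₀ *_) (C-drop∸ m′ k′) ⟩
    suc m * c₀ * ((suc m′ ∸ k′) * (suc m′ C k′))           ≡⟨ lem₂ (suc m) c₀ (suc m′ ∸ k′) _ ⟩
    suc m * (suc m′ ∸ k′) * (c₀ * (suc m′ C k′))           ≤⟨ *-mono-≤ ratios (subst₂ (λ x y → c₀ * (y C k′) ≤ (x C k) * d₁) eq eq′ ih) ⟩
    suc m′ * (suc m ∸ k) * ((suc m C k) * d₁)              ≡⟨ lem₃ (suc m′) (suc m ∸ k) (suc m C k) d₁ ⟩
    suc m′ * ((suc m ∸ k) * (suc m C k)) * d₁              ≡⟨ cong (λ x → suc m′ * x * d₁) (C-drop∸ m k) ⟨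
    suc m′ * (suc m * (m C k)) * d₁                        ≡⟨ lem₄ (suc m′) (suc m) (m C k) d₁ ⟩
    suc m * suc m′ * ((m C k) * d₁)                        ∎)
    where
    m = n ∸ suc a
    m′ = n′ ∸ suc (b + a)
    c₀ = n C k
    d₁ = (n′ ∸ b) C k′
    b+a<′ : b + a < n′
    b+a<′ = subst (_≤ n′) (+-suc b a) b+a<n′
    eq : n ∸ a ≡ suc m
    eq = ∸-suc< a<n
    eq′ : n′ ∸ (b + a) ≡ suc m′
    eq′ = ∸-suc< b+a<′
    ratio′ : k * (n′ ∸ b) ≤ k′ * (n ∸ a)
    ratio′ = ≤-trans ratio (*-monoʳ-≤ k′ (∸-monoʳ-≤ n (n≤1+n a)))
    ih : c₀ * ((n′ ∸ (b + a)) C k′) ≤ ((n ∸ a) C k) * d₁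
    ih = shift-all a ratio′ (<⇒≤ a<n) (<⇒≤ b+a<′)
    -- The hypothesis gives k / (n - a) ≤ k′ / (n′ - b), and taking further points from the second
    -- block only increases the right-hand side.
    km′≤ : suc m′ * k ≤ suc m * k′
    km′≤ = begin
      suc m′ * k            ≡⟨ *-comm (suc m′) k ⟩
      k * suc m′            ≡⟨ cong (k *_) eq′ ⟨
      k * (n′ ∸ (b + a))    ≤⟨ *-monoʳ-≤ k (∸-monoʳ-≤ n′ (m≤m+n b a)) ⟩
      k * (n′ ∸ b)          ≤⟨ ratio′ ⟩
      k′ * (n ∸ a)          ≡⟨ cong (k′ *_) eq ⟩
      k′ * suc m            ≡⟨ *-comm k′ (suc m) ⟩
      suc m * k′            ∎
    ratios : suc m * (suc m′ ∸ k′) ≤ suc m′ * (suc m ∸ k)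
    ratios = begin
      suc m * (suc m′ ∸ k′)               ≡⟨ *-distribˡ-∸ (suc m) (suc m′) k′ ⟩
      suc m * suc m′ ∸ suc m * k′         ≤⟨ ∸-monoʳ-≤ (suc m * suc m′) km′≤ ⟩
      suc m * suc m′ ∸ suc m′ * k         ≡⟨ cong (_∸ suc m′ * k) (*-comm (suc m) (suc m′)) ⟩
      suc m′ * suc m ∸ suc m′ * k         ≡⟨ *-distribˡ-∸ (suc m′) (suc m) k ⟨
      suc m′ * (suc m ∸ k)                ∎
    lem₁ : ∀ m m′ c d → m * m′ * (c * d) ≡ m * c * (m′ * d)
    lem₁ = solve-∀
    lem₂ : ∀ m c x d → m * c * (x * d) ≡ m * x * (c * d)
    lem₂ = solve-∀
    lem₃ : ∀ m x c d → m * x * (c * d) ≡ m * (x * c) * d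
    lem₃ = solve-∀
    lem₄ : ∀ m′ m c d → m′ * (m * c) * d ≡ m * m′ * (c * d)
    lem₄ = solve-∀

-- Comparing k / (n - a) with k′ / (n′ - b) tells which block loses the larger proportion per point;
-- by `shift-all` that block may take all a + b points.
two-blocks : ∀ n k n′ k′ a b → a + b ≤ n → a + b ≤ n′ →
  (((n ∸ (a + b)) C k) * (n′ C k′) ≤ ((n ∸ a) C k) * ((n′ ∸ b) C k′)) ⊎
  ((n C k) * ((n′ ∸ (a + b)) C k′) ≤ ((n ∸ a) C k) * ((n′ ∸ b) C k′))
two-blocks n k n′ k′ a b ≤n ≤n′ with ≤-total (k * (n′ ∸ b)) (k′ * (n ∸ a))
... | inj₁ le = inj₂ (subst (λ x → (n C k) * ((n′ ∸ x) C k′) ≤ ((n ∸ a) C k) * ((n′ ∸ b) C k′)) (+-comm b a)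
  (shift-all n k n′ k′ b a le (≤-trans (m≤m+n a b) ≤n) (subst (_≤ n′) (+-comm a b) ≤n′)))
... | inj₂ ge = inj₁ (subst₂ _≤_ (*-comm (n′ C k′) ((n ∸ (a + b)) C k)) (*-comm ((n′ ∸ b) C k′) ((n ∸ a) C k))
  (shift-all n′ k′ n k a b ge (≤-trans (m≤n+m b a) ≤n′) ≤n))

spike : ∀ {ℓ} → ℕ → Fin ℓ → Fin ℓ → ℕ
spike s i j = if does (j Fin.≟ i) then s else 0

spike-same : ∀ {ℓ} s (i : Fin ℓ) → spike s i i ≡ s
spike-same s i with i Fin.≟ i
... | yes _ = refl
... | no i≢i = contradiction refl i≢i

spike-other : ∀ {ℓ} s {i j : Fin ℓ} → j ≢ i → spike s i j ≡ 0
spike-other s {i} {j} j≢i with j Fin.≟ i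
... | yes j≡i = contradiction j≡i j≢i
... | no _ = refl

total-spike : ∀ {ℓ} s (i : Fin ℓ) → total (spike s i) ≡ s
total-spike {suc ℓ} s zero = trans (cong (s +_) (total-zero {ℓ})) (+-identityʳ s)
total-spike s (suc i) = total-spike s i

prod-spike : ∀ {ℓ} (c : Fin ℓ → ℕ → ℕ) s i → prod (λ j → c j (spike s i j)) ≡ c i s * prodExcept ℓ i (λ j → c j 0)
prod-spike c s i = trans (prod-split i (λ j → c j (spike s i j))) (cong₂ (λ x y → c i x * y) (spike-same s i)
  (prodExcept-cong i (λ j j≢i → cong (c j) (spike-other s j≢i))))

-- Induction on the number of blocks: the points outside block 0 are first gathered in one block,
-- which the hypothesis on two blocks then merges with block 0, in one direction or the other.
concentrate : ∀ {ℓ} m (c : Fin (suc ℓ) → ℕ → ℕ) →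
  (∀ i j a b → a + b ≤ m → (c i (a + b) * c j 0 ≤ c i a * c j b) ⊎ (c i 0 * c j (a + b) ≤ c i a * c j b)) →
  (h : Fin (suc ℓ) → ℕ) → total h ≤ m → ∃ λ i → prod (λ j → c j (spike (total h) i j)) ≤ prod (λ j → c j (h j))
concentrate {zero} m c _ h _ = zero , ≤-reflexive (cong (λ x → c zero x * 1) (+-identityʳ (h zero)))
concentrate {suc ℓ} m c two h h≤m = step (concentrate m (c ∘ suc) (λ i j → two (suc i) (suc j)) (h ∘ suc) (≤-trans (m≤n+m S (h zero)) h≤m))
  where
  S = total (h ∘ suc)
  P = prod (λ j → c (suc j) (h (suc j)))
  regroup : ∀ x y z → x * (y * z) ≡ y * x * z
  regroup = solve-∀
  step : (∃ λ i → prod (λ j → c (suc j) (spike S i j)) ≤ P) → ∃ λ i → prod (λ j → c j (spike (h zero + S) i j)) ≤ c zero (h zero) * P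
  step (i , ih) = choose (two (suc i) zero S (h zero) (subst (_≤ m) (+-comm (h zero) S) h≤m))
    where
    R = prodExcept (suc ℓ) i (λ j → c (suc j) 0)
    finish : ∀ y → y ≤ c (suc i) S * c zero (h zero) → y * R ≤ c zero (h zero) * P
    finish y le = begin
      y * R                                     ≤⟨ *-monoˡ-≤ R le ⟩
      c (suc i) S * c zero (h zero) * R         ≡⟨ regroup (c zero (h zero)) (c (suc i) S) R ⟨
      c zero (h zero) * (c (suc i) S * R)       ≡⟨ cong (c zero (h zero) *_) (prod-spike (c ∘ suc) S i) ⟨
      c zero (h zero) * prod (λ j → c (suc j) (spike S i j))   ≤⟨ *-monoʳ-≤ (c zero (h zero)) ih ⟩
      c zero (h zero) * P                       ∎
    choose : (c (suc i) (S + h zero) * c zero 0 ≤ c (suc i) S * c zero (h zero)) ⊎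
             (c (suc i) 0 * c zero (S + h zero) ≤ c (suc i) S * c zero (h zero)) →
             ∃ λ i → prod (λ j → c j (spike (h zero + S) i j)) ≤ c zero (h zero) * P
    choose (inj₁ le) = suc i , (begin
      c zero 0 * prod (λ j → c (suc j) (spike (h zero + S) i j))    ≡⟨ cong (c zero 0 *_) (prod-spike (c ∘ suc) (h zero + S) i) ⟩
      c zero 0 * (c (suc i) (h zero + S) * R)                       ≡⟨ cong (λ x → c zero 0 * (c (suc i) x * R)) (+-comm (h zero) S) ⟩
      c zero 0 * (c (suc i) (S + h zero) * R)                       ≡⟨ regroup (c zero 0) (c (suc i) (S + h zero)) R ⟩
      c (suc i) (S + h zero) * c zero 0 * R                         ≤⟨ finish _ le ⟩
      c zero (h zero) * P                                           ∎)
    choose (inj₂ le) = zero , (begin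
      c zero (h zero + S) * prod (λ j → c (suc j) 0)                ≡⟨ cong₂ (λ x y → c zero x * y) (+-comm (h zero) S) (prod-split i (λ j → c (suc j) 0)) ⟩
      c zero (S + h zero) * (c (suc i) 0 * R)                       ≡⟨ regroup (c zero (S + h zero)) (c (suc i) 0) R ⟩
      c (suc i) 0 * c zero (S + h zero) * R                         ≤⟨ finish _ le ⟩
      c zero (h zero) * P                                           ∎)

-- A union bound: the sets lost at one removal contain the removed point, so they number at most C(n
-- - 1, k - 1) = (k / n) C(n, k).
C-loss : ∀ n k h → h ≤ n → n * (n C k) ≤ n * ((n ∸ h) C k) + h * (k * (n C k))
C-loss n k zero _ = ≤-reflexive (sym (+-identityʳ _))
C-loss n zero (suc h) _ = m≤m+n _ _
C-loss (suc n) (suc k) (suc h) (s≤s h≤n) = begin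
  suc n * c                                                       ≤⟨ C-loss (suc n) (suc k) h (m≤n⇒m≤1+n h≤n) ⟩
  suc n * ((suc n ∸ h) C suc k) + h * (suc k * c)                 ≡⟨ cong (λ x → suc n * (x C suc k) + h * (suc k * c)) (∸-suc< (s≤s h≤n)) ⟩
  suc n * (suc m C suc k) + h * (suc k * c)                       ≡⟨ cong (λ x → suc n * x + h * (suc k * c)) (nCk+nC[k+1]≡[n+1]C[k+1] m k) ⟨
  suc n * ((m C k) + (m C suc k)) + h * (suc k * c)               ≤⟨ +-monoˡ-≤ _ (*-monoʳ-≤ (suc n) (+-monoˡ-≤ _ (C-monoˡ k (m∸n≤m n h)))) ⟩
  suc n * ((n C k) + (m C suc k)) + h * (suc k * c)               ≡⟨ lem (suc n) (n C k) (m C suc k) h (suc k * c) ⟩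
  suc n * (m C suc k) + (suc n * (n C k) + h * (suc k * c))       ≡⟨ cong (λ x → suc n * (m C suc k) + (x + h * (suc k * c))) (absorption n k) ⟨
  suc n * (m C suc k) + (suc k * c + h * (suc k * c))             ∎
  where
  m = n ∸ h
  c = suc n C suc k
  lem : ∀ N a b h x → N * (a + b) + h * x ≡ N * b + (N * a + h * x)
  lem = solve-∀

-- The exact proportion lost is k / (n - t), at least k / n. The denominator that does not depend on
-- t is what allows the steps to be summed in `telescope`.
C-gain : ∀ n k t → t < n → k * ((n ∸ t) C k) + n * ((n ∸ suc t) C k) ≤ n * ((n ∸ t) C k)
C-gain n k t t<n rewrite ∸-suc< t<n = begin
  k * (suc m C k) + n * (m C k)                        ≡⟨ cong (λ x → k * (suc m C k) + x * (m C k)) n≡ ⟩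
  k * (suc m C k) + (suc m + t) * (m C k)              ≡⟨ lem k (suc m C k) (suc m) t (m C k) ⟩
  (suc m * (m C k) + k * (suc m C k)) + t * (m C k)    ≡⟨ cong (_+ t * (m C k)) (C-drop m k) ⟩
  suc m * (suc m C k) + t * (m C k)                    ≤⟨ +-monoʳ-≤ _ (*-monoʳ-≤ t (C-monoˡ k (n≤1+n m))) ⟩
  suc m * (suc m C k) + t * (suc m C k)                ≡⟨ *-distribʳ-+ (suc m C k) (suc m) t ⟨
  (suc m + t) * (suc m C k)                            ≡⟨ cong (_* (suc m C k)) n≡ ⟨
  n * (suc m C k)                                      ∎
  where
  m = n ∸ suc t
  n≡ : n ≡ suc m + t
  n≡ = trans (sym (m∸n+n≡m (<⇒≤ t<n))) (cong (_+ t) (∸-suc< t<n))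
  lem : ∀ k c m t d → k * c + (m + t) * d ≡ (m * d + k * c) + t * d
  lem = solve-∀

-- The relative losses of the factors add up: they are replaced one at a time, and in each error
-- term the smaller factors `c` are estimated by `c₀`.
prod-loss : ∀ {ℓ} L X (c c₀ h : Fin ℓ → ℕ) → (∀ i → c i ≤ c₀ i) → (∀ i → L * c₀ i ≤ L * c i + h i * (X * c₀ i)) →
  L * prod c₀ ≤ L * prod c + total h * (X * prod c₀)
prod-loss {zero} L X c c₀ h _ _ = ≤-reflexive (sym (+-identityʳ _))
prod-loss {suc ℓ} L X c c₀ h c≤ loss = begin
  L * (c₀ zero * P₀)                                                             ≡⟨ lem₁ L (c₀ zero) P₀ ⟩
  c₀ zero * (L * P₀)                                                             ≤⟨ *-monoʳ-≤ (c₀ zero) (prod-loss L X (c ∘ suc) (c₀ ∘ suc) (h ∘ suc) (c≤ ∘ suc) (loss ∘ suc)) ⟩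
  c₀ zero * (L * P + T * (X * P₀))                                               ≡⟨ lem₂ (c₀ zero) L P (T * (X * P₀)) ⟩
  L * c₀ zero * P + c₀ zero * (T * (X * P₀))                                     ≤⟨ +-monoˡ-≤ _ (*-monoˡ-≤ P (loss zero)) ⟩
  (L * c zero + h zero * (X * c₀ zero)) * P + c₀ zero * (T * (X * P₀))           ≡⟨ cong (_+ c₀ zero * (T * (X * P₀))) (*-distribʳ-+ P (L * c zero) _) ⟩
  L * c zero * P + h zero * (X * c₀ zero) * P + c₀ zero * (T * (X * P₀))         ≤⟨ +-monoˡ-≤ _ (+-monoʳ-≤ (L * c zero * P) (*-monoʳ-≤ (h zero * (X * c₀ zero)) (prod-mono (c≤ ∘ suc)))) ⟩
  L * c zero * P + h zero * (X * c₀ zero) * P₀ + c₀ zero * (T * (X * P₀))        ≡⟨ lem₃ L (c zero) P (h zero) X (c₀ zero) P₀ T ⟩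
  L * (c zero * P) + (h zero + T) * (X * (c₀ zero * P₀))                         ∎
  where
  P = prod (c ∘ suc)
  P₀ = prod (c₀ ∘ suc)
  T = total (h ∘ suc)
  lem₁ : ∀ L c P → L * (c * P) ≡ c * (L * P)
  lem₁ = solve-∀
  lem₂ : ∀ c L P y → c * (L * P + y) ≡ L * c * P + c * y
  lem₂ = solve-∀
  lem₃ : ∀ L c P h X c₀ P₀ T → L * c * P + h * (X * c₀) * P₀ + c₀ * (T * (X * P₀)) ≡ L * (c * P) + (h + T) * (X * (c₀ * P₀))
  lem₃ = solve-∀

enumerate-size : ∀ {n} (c : Fin n → Mark) k {S} → S ∈ enumerate c k → ∣ S ∣ ≡ k
enumerate-size {zero} c zero (here refl) = refl
enumerate-size {suc n} c k S∈ with c zero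
... | required = in-case c k S∈
  where
  in-case : ∀ {n} (c : Fin (suc n) → Mark) k {S} → S ∈ with-inside (enumerate (c ∘ suc)) k → ∣ S ∣ ≡ k
  in-case c (suc k) S∈ with _ , S∈′ , refl ← ∈-map⁻ (inside ∷_) S∈ = cong suc (enumerate-size (c ∘ suc) k S∈′)
... | forbidden with _ , S∈′ , refl ← ∈-map⁻ (outside ∷_) S∈ = enumerate-size (c ∘ suc) k S∈′
enumerate-size {suc n} c k S∈ | free with ∈-++⁻ (map (outside ∷_) (enumerate (c ∘ suc) k)) S∈
... | inj₁ S∈₁ with _ , S∈′ , refl ← ∈-map⁻ (outside ∷_) S∈₁ = enumerate-size (c ∘ suc) k S∈′
enumerate-size {suc n} c (suc k) S∈ | free | inj₂ S∈₂ with _ , S∈′ , refl ← ∈-map⁻ (inside ∷_) S∈₂ = cong suc (enumerate-size (c ∘ suc) k S∈′)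

elements : ∀ {m} → Subset m → List (Fin m)
elements [] = []
elements (true ∷ S) = zero ∷ map suc (elements S)
elements (false ∷ S) = map suc (elements S)

length-elements : ∀ {m} (S : Subset m) → length (elements S) ≡ ∣ S ∣
length-elements [] = refl
length-elements (true ∷ S) = cong suc (trans (length-map suc (elements S)) (length-elements S))
length-elements (false ∷ S) = trans (length-map suc (elements S)) (length-elements S)

∈-elements⁺ : ∀ {m} (S : Subset m) {x} → Vec.lookup S x ≡ inside → x ∈ elements S
∈-elements⁺ (true ∷ S) {zero} _ = here refl
∈-elements⁺ (true ∷ S) {suc x} eq = there (∈-map⁺ suc (∈-elements⁺ S eq))
∈-elements⁺ (false ∷ S) {suc x} eq = ∈-map⁺ suc (∈-elements⁺ S eq)

∈-elements⁻ : ∀ {m} (S : Subset m) {x} → x ∈ elements S → Vec.lookup S x ≡ inside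
∈-elements⁻ (true ∷ S) (here refl) = refl
∈-elements⁻ (true ∷ S) (there x∈) with _ , y∈ , refl ← ∈-map⁻ suc x∈ = ∈-elements⁻ S y∈
∈-elements⁻ (false ∷ S) x∈ with _ , y∈ , refl ← ∈-map⁻ suc x∈ = ∈-elements⁻ S y∈

-- The direct product as a spread hypergraph

module Blocks {ℓ : ℕ} (n : Fin ℓ → ℕ) where

  Vertex : Set
  Vertex = Σ (Fin ℓ) (λ i → Fin (n i))

  at : ∀ i → Fin (n i) → Vertex
  at i x = i , x

  _≟ᵥ_ : DecidableEquality Vertex
  _≟ᵥ_ = ≡-dec Fin._≟_ Fin._≟_

  open DecMem _≟ᵥ_ using (_∈?_)

  verticesOf : GSet ℓ n → List Vertex
  verticesOf F = concatMap (λ i → map (at i) (elements (F i))) (allFin ℓ)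

  ∈-verticesOf⁺ : ∀ F {i x} → Vec.lookup (F i) x ≡ inside → (i , x) ∈ verticesOf F
  ∈-verticesOf⁺ F {i} eq = ∈-concatMap⁺ (λ i → map (at i) (elements (F i)))
    (Any.map (λ { refl → ∈-map⁺ (i ,_) (∈-elements⁺ (F i) eq) }) (∈-allFin i))

  ∈-verticesOf⁻ : ∀ F {i x} → (i , x) ∈ verticesOf F → Vec.lookup (F i) x ≡ inside
  ∈-verticesOf⁻ F v∈ with j , _ , v∈′ ← find (∈-concatMap⁻ (λ i → map (at i) (elements (F i))) {xs = allFin ℓ} v∈)
    with _ , x∈ , refl ← ∈-map⁻ (at j) v∈′ = ∈-elements⁻ (F j) x∈

  sumBy-verticesOf : (g : Fin ℓ → ℕ) (F : GSet ℓ n) → sumBy (g ∘ proj₁) (verticesOf F) ≡ total (λ i → ∣ F i ∣ * g i)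
  sumBy-verticesOf g F = trans (concat-sum (allFin ℓ)) (cong sum (map-tabulate id (λ i → ∣ F i ∣ * g i)))
    where
    block-sum : ∀ i xs → sumBy (g ∘ proj₁) (map (at i) xs) ≡ length xs * g i
    block-sum i [] = refl
    block-sum i (x ∷ xs) = cong (g i +_) (block-sum i xs)
    concat-sum : ∀ is → sumBy (g ∘ proj₁) (concatMap (λ i → map (at i) (elements (F i))) is) ≡ sum (map (λ i → ∣ F i ∣ * g i) is)
    concat-sum [] = refl
    concat-sum (i ∷ is) = trans (sumBy-++ (g ∘ proj₁) (map (at i) (elements (F i))) _)
      (cong₂ _+_ (trans (block-sum i (elements (F i))) (cong (_* g i) (length-elements (F i)))) (concat-sum is))

  length-verticesOf : (F : GSet ℓ n) → length (verticesOf F) ≡ total (λ i → ∣ F i ∣)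
  length-verticesOf F = trans (ones (verticesOf F)) (trans (sumBy-verticesOf (λ _ → 1) F) (total-cong {f = λ i → ∣ F i ∣ * 1} {λ i → ∣ F i ∣} (λ i → *-identityʳ _)))
    where
    ones : ∀ xs → length xs ≡ sumBy {A = Vertex} (λ _ → 1) xs
    ones [] = refl
    ones (_ ∷ xs) = cong suc (ones xs)

  vertices : List Vertex
  vertices = deduplicate _≟ᵥ_ (verticesOf (λ _ → Vec.replicate _ inside))

  vertices-complete : ∀ v → v ∈ vertices
  vertices-complete (i , x) = ∈-deduplicate⁺ _≟ᵥ_ (∈-verticesOf⁺ (λ _ → Vec.replicate _ inside) (Vecₚ.lookup-replicate x inside))

  vertices! : Unique vertices
  vertices! = deduplicate-! _≟ᵥ_ (verticesOf (λ _ → Vec.replicate _ inside))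

  blockSize : List Vertex → Fin ℓ → ℕ
  blockSize [] i = 0
  blockSize ((j , _) ∷ B) i = spike 1 j i + blockSize B i

  total-blockSize : ∀ B → total (blockSize B) ≡ length B
  total-blockSize [] = total-zero {ℓ}
  total-blockSize ((j , _) ∷ B) = trans (total-+ (spike 1 j) (blockSize B)) (cong₂ _+_ (total-spike 1 j) (total-blockSize B))

  mark : Mark → List Vertex → ∀ i → Fin (n i) → Mark
  mark m B i x = if does ((i , x) ∈? B) then m else free

  mark-∈ : ∀ m {B i x} → (i , x) ∈ B → mark m B i x ≡ m
  mark-∈ m {B} {i} {x} v∈ with (i , x) ∈? B
  ... | yes _ = refl
  ... | no v∉ = contradiction v∈ v∉

  mark-∉ : ∀ m {B i x} → (i , x) ∉ B → mark m B i x ≡ free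
  mark-∉ m {B} {i} {x} v∉ with (i , x) ∈? B
  ... | yes v∈ = contradiction v∈ v∉
  ... | no _ = refl

  mark-∷ : ∀ m v B {i x} → (i , x) ≢ v → mark m (v ∷ B) i x ≡ mark m B i x
  mark-∷ m v B {i} {x} ≢v = cases ((i , x) ∈? B)
    where
    cases : Dec ((i , x) ∈ B) → mark m (v ∷ B) i x ≡ mark m B i x
    cases (yes v∈) = trans (mark-∈ m {v ∷ B} (there v∈)) (sym (mark-∈ m v∈))
    cases (no v∉) = trans (mark-∉ m {v ∷ B} (λ { (here eq) → ≢v eq ; (there v∈) → v∉ v∈ })) (sym (mark-∉ m v∉))

  fit-mark : ∀ m B (F : GSet ℓ n) → (∀ {i x} → (i , x) ∈ B → Vec.lookup (F i) x fits m) → ∀ i x → Vec.lookup (F i) x fits mark m B i x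
  fit-mark m B F fit i x with (i , x) ∈? B
  ... | yes v∈ = fit v∈
  ... | no _ = tt

  -- Adding (j, x) changes the mark of this one vertex from `free` to `m`. Old and new weight stand
  -- on opposite sides to avoid truncated subtraction.
  weight-mark : (w : Mark → ℕ) (m : Mark) → ∀ {j x B} → Unique ((j , x) ∷ B) → ∀ i →
    total (w ∘ mark m ((j , x) ∷ B) i) + spike (w free) j i ≡ total (w ∘ mark m B i) + spike (w m) j i
  weight-mark w m {j} {x} {B} u i = cases i (i Fin.≟ j)
    where
    exchange : ∀ {m} {f g : Fin m → ℕ} {a b} (x : Fin m) → f x ≡ a → g x ≡ b → (∀ y → y ≢ x → f y ≡ g y) →
      total f + b ≡ total g + a
    exchange {f = f} {g} {a} {b} zero refl refl f≡g = trans (cong (λ t → f zero + t + g zero) (total-cong (λ y → f≡g (suc y) (λ ()))))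
      (lem (f zero) _ (g zero))
      where
      lem : ∀ a t b → a + t + b ≡ b + t + a
      lem = solve-∀
    exchange {f = f} {g} (suc x) fx gx f≡g = trans (+-assoc (f zero) _ _)
      (trans (cong₂ _+_ (f≡g zero (λ ())) (exchange x fx gx (λ y y≢x → f≡g (suc y) (y≢x ∘ Finₚ.suc-injective)))) (sym (+-assoc (g zero) _ _)))
    cases : ∀ i → Dec (i ≡ j) → total (w ∘ mark m ((j , x) ∷ B) i) + spike (w free) j i ≡ total (w ∘ mark m B i) + spike (w m) j i
    cases i (no i≢j) = cong₂ _+_ (total-cong {f = w ∘ mark m ((j , x) ∷ B) i} {w ∘ mark m B i} (λ y → cong w (mark-∷ m (j , x) B (λ { refl → i≢j refl }))))
      (trans (spike-other (w free) i≢j) (sym (spike-other (w m) i≢j)))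
    cases i (yes refl) = trans (cong (total (w ∘ mark m ((j , x) ∷ B) i) +_) (spike-same (w free) i))
      (trans (exchange x
        (cong w (mark-∈ m {(j , x) ∷ B} (here refl))) (cong w (mark-∉ m (Unique-head u)))
        (λ y y≢x → cong w (mark-∷ m (j , x) B (λ { refl → y≢x refl }))))
      (cong (total (w ∘ mark m B i) +_) (sym (spike-same (w m) i))))

  spike-zero : ∀ (j i : Fin ℓ) → spike 0 j i ≡ 0
  spike-zero j i with i Fin.≟ j
  ... | yes _ = refl
  ... | no _ = refl

  free-mark : ∀ m → isFree m ≡ 0 → ∀ B → Unique B → ∀ i → total (isFree ∘ mark m B i) + blockSize B i ≡ n i
  free-mark m _ [] _ i = trans (+-identityʳ _) (trans (total-const (n i) 1) (*-identityʳ _))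
  free-mark m m≢free ((j , x) ∷ B) u@(_ ∷ u′) i = begin-equality
    total (isFree ∘ mark m ((j , x) ∷ B) i) + (spike 1 j i + blockSize B i)   ≡⟨ +-assoc (total (isFree ∘ mark m ((j , x) ∷ B) i)) (spike 1 j i) _ ⟨
    total (isFree ∘ mark m ((j , x) ∷ B) i) + spike 1 j i + blockSize B i     ≡⟨ cong (_+ blockSize B i) (weight-mark isFree m u i) ⟩
    total (isFree ∘ mark m B i) + spike (isFree m) j i + blockSize B i        ≡⟨ cong (λ a → total (isFree ∘ mark m B i) + spike a j i + blockSize B i) m≢free ⟩
    total (isFree ∘ mark m B i) + spike 0 j i + blockSize B i                 ≡⟨ cong (λ a → total (isFree ∘ mark m B i) + a + blockSize B i) (spike-zero j i) ⟩
    total (isFree ∘ mark m B i) + 0 + blockSize B i                           ≡⟨ cong (_+ blockSize B i) (+-identityʳ _) ⟩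
    total (isFree ∘ mark m B i) + blockSize B i                               ≡⟨ free-mark m m≢free B u′ i ⟩
    n i                                                                       ∎

  required-mark : ∀ B → Unique B → ∀ i → total (isRequired ∘ mark required B i) ≡ blockSize B i
  required-mark [] _ i = total-zero {n i}
  required-mark ((j , x) ∷ B) u@(_ ∷ u′) i = begin-equality
    total (isRequired ∘ mark required ((j , x) ∷ B) i)                    ≡⟨ +-identityʳ _ ⟨
    total (isRequired ∘ mark required ((j , x) ∷ B) i) + 0                ≡⟨ cong (total (isRequired ∘ mark required ((j , x) ∷ B) i) +_) (spike-zero j i) ⟨
    total (isRequired ∘ mark required ((j , x) ∷ B) i) + spike 0 j i      ≡⟨ weight-mark isRequired required u i ⟩
    total (isRequired ∘ mark required B i) + spike 1 j i                  ≡⟨ cong (_+ spike 1 j i) (required-mark B u′ i) ⟩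
    blockSize B i + spike 1 j i                                           ≡⟨ +-comm (blockSize B i) _ ⟩
    spike 1 j i + blockSize B i                                           ∎

  forbidden-mark : ∀ B i → total (isRequired ∘ mark forbidden B i) ≡ 0
  forbidden-mark B i = trans (total-cong none) (total-zero {n i})
    where
    none : ∀ x → isRequired (mark forbidden B i x) ≡ 0
    none x with (i , x) ∈? B
    ... | yes _ = refl
    ... | no _ = refl

  free≡ : ∀ m → isFree m ≡ 0 → ∀ B → Unique B → ∀ i → total (isFree ∘ mark m B i) ≡ n i ∸ blockSize B i
  free≡ m m≢free B u i = trans (sym (m+n∸n≡m _ (blockSize B i))) (cong (_∸ blockSize B i) (free-mark m m≢free B u i))

  blockSize≤ : ∀ B → Unique B → ∀ i → blockSize B i ≤ n i
  blockSize≤ B u i = subst (blockSize B i ≤_) (free-mark required refl B u i) (m≤n+m _ _)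

  module Family (k : Fin ℓ → ℕ) (𝓕 : List (GSet ℓ n)) (distinct : IsFamily 𝓕) (sizes : All (InProduct n k) 𝓕) where

    N L : ℕ
    N = prod (λ i → n i C k i)
    L = prod n

    -- This is L k_i / n_i, the weight of a vertex of block i over the common denominator.
    Xᵢ : Fin ℓ → ℕ
    Xᵢ i = k i * prodExcept ℓ i n

    X : Vertex → ℕ
    X = Xᵢ ∘ proj₁

    open Hypergraph _≟ᵥ_ verticesOf 𝓕 X

    avoiding : List Vertex → List (GSet ℓ n)
    avoiding H = sections (λ i → enumerate (mark forbidden H i) (k i))

    length-avoiding : ∀ H → Unique H → prod (λ i → length (enumerate (mark forbidden H i) (k i))) ≡ prod (λ i → (n i ∸ blockSize H i) C k i)
    length-avoiding H u = prod-cong λ i → trans (length-enumerate (mark forbidden H i) (k i))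
      (cong₂ (λ b f → ways b f (k i)) (forbidden-mark H i) (free≡ forbidden refl H u i))

    family≤N : ∀ 𝓖 → IsFamily 𝓖 → (∀ {F} → F ∈ 𝓖 → InProduct n k F) → length 𝓖 ≤ N
    family≤N 𝓖 d sz = subst (length 𝓖 ≤_) (length-avoiding [] [])
      (family-≤ (λ i → enumerate (mark forbidden [] i) (k i)) 𝓖 d
        (λ {F} F∈ i → subst (λ c → F i ∈ enumerate (mark forbidden [] i) c) (sz F∈ i)
          (enumerate-complete _ (F i) (fit-mark forbidden [] F (λ ()) i))))

    hits? : ∀ H → Decidable (λ F → ¬ Avoids H F)
    hits? H F = ¬? (avoids? H F)

    length-split : ∀ H → length 𝓕 ≤ count (hits? H) 𝓕 + count (avoids? H) 𝓕
    length-split H = go 𝓕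
      where
      go : ∀ 𝓖 → length 𝓖 ≤ count (hits? H) 𝓖 + count (avoids? H) 𝓖
      go [] = z≤n
      go (F ∷ 𝓖) with ih ← go 𝓖 | avoids? H F
      ... | yes _ = ≤-trans (s≤s ih) (≤-reflexive (sym (+-suc _ _)))
      ... | no _ = s≤s ih

    -- The members of `𝓕` that meet `H` and all members of the product that avoid `H` form together
    -- a family without repetitions inside the product.
    count-hits : ∀ H → Unique H → count (hits? H) 𝓕 + prod (λ i → (n i ∸ blockSize H i) C k i) ≤ N
    count-hits H u = begin
      count (hits? H) 𝓕 + prod (λ i → (n i ∸ blockSize H i) C k i)     ≡⟨ cong (count (hits? H) 𝓕 +_) (trans (length-sections choices) (length-avoiding H u)) ⟨
      count (hits? H) 𝓕 + length (avoiding H)                          ≡⟨ length-++ (filter (hits? H) 𝓕) ⟨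
      length (filter (hits? H) 𝓕 ++ avoiding H)                        ≤⟨ family≤N _ all-distinct all-sizes ⟩
      N                                                                ∎
      where
      choices = λ i → enumerate (mark forbidden H i) (k i)
      avoids : ∀ {F} → F ∈ avoiding H → ∀ {i x} → (i , x) ∈ H → Vec.lookup (F i) x ≡ outside
      avoids {F} F∈ {i} {x} v∈ = subst (Vec.lookup (F i) x fits_) (mark-∈ forbidden v∈)
        (enumerate-sound (mark forbidden H i) (k i) (sections-sound choices F∈ i) x)
      all-distinct : IsFamily (filter (hits? H) 𝓕 ++ avoiding H)
      all-distinct = AllPairsₚ.++⁺ (AllPairsₚ.filter⁺ (hits? H) distinct)
        (sections-distinct choices (λ i → enumerate! (mark forbidden H i) (k i)))
        (All.tabulate λ {F} F∈ → All.tabulate λ {G} G∈ F≡G →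
          proj₂ (∈-filter⁻ (hits? H) {xs = 𝓕} F∈) (All.tabulate λ {v} v∈ v∈F →
            contradiction (trans (sym (∈-verticesOf⁻ F v∈F)) (trans (cong (λ S → Vec.lookup S (proj₂ v)) (F≡G (proj₁ v))) (avoids G∈ v∈))) λ ()))
      all-sizes : ∀ {F} → F ∈ filter (hits? H) 𝓕 ++ avoiding H → InProduct n k F
      all-sizes F∈ with ∈-++⁻ (filter (hits? H) 𝓕) F∈
      ... | inj₁ F∈₁ = All.lookup sizes (proj₁ (∈-filter⁻ (hits? H) {xs = 𝓕} F∈₁))
      ... | inj₂ F∈₂ = λ i → enumerate-size (mark forbidden H i) (k i) (sections-sound choices F∈₂ i)

    avoid-bound : ∀ H → Unique H → length 𝓕 + prod (λ i → (n i ∸ blockSize H i) C k i) ≤ N + count (avoids? H) 𝓕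
    avoid-bound H u = begin
      length 𝓕 + P                        ≤⟨ +-monoˡ-≤ P (length-split H) ⟩
      h + f + P                           ≡⟨ lem h f P ⟩
      h + P + f                           ≤⟨ +-monoˡ-≤ f (count-hits H u) ⟩
      N + f                               ∎
      where
      P = prod (λ i → (n i ∸ blockSize H i) C k i)
      h = count (hits? H) 𝓕
      f = count (avoids? H) 𝓕
      lem : ∀ a b c → a + b + c ≡ a + c + b
      lem = solve-∀

    supersets : List Vertex → Fin ℓ → ℕ
    supersets B i = ways (blockSize B i) (n i ∸ blockSize B i) (k i)

    count-contains : ∀ B → Unique B → count (contains? B) 𝓕 ≤ prod (supersets B)
    count-contains B u = subst (count (contains? B) 𝓕 ≤_)
      (prod-cong λ i → trans (length-enumerate (mark required B i) (k i))
        (cong₂ (λ b f → ways b f (k i)) (required-mark B u i) (free≡ required refl B u i)))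
      (family-≤ (λ i → enumerate (mark required B i) (k i)) (filter (contains? B) 𝓕) (AllPairsₚ.filter⁺ (contains? B) distinct) member)
      where
      member : ∀ {F} → F ∈ filter (contains? B) 𝓕 → ∀ i → F i ∈ enumerate (mark required B i) (k i)
      member {F} F∈ i with F∈𝓕 , B⊆F ← ∈-filter⁻ (contains? B) {xs = 𝓕} F∈ =
        subst (λ c → F i ∈ enumerate (mark required B i) c) (All.lookup sizes F∈𝓕 i)
          (enumerate-complete _ (F i) (fit-mark required B F (λ v∈ → ∈-verticesOf⁻ F (All.lookup B⊆F v∈)) i))

    -- Only the factor of the block of `v` changes, and by `ways-ratio` it shrinks at least by k_i /
    -- n_i, which is X v / L.
    supersets-∷ : ∀ v B → Unique (v ∷ B) → prod (supersets (v ∷ B)) * L ≤ X v * prod (supersets B)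
    supersets-∷ (i , x) B u = begin
      prod (supersets ((i , x) ∷ B)) * L                   ≡⟨ cong₂ _*_ (prod-split i _) (prod-split i n) ⟩
      supersets ((i , x) ∷ B) i * R′ * (n i * Rₙ)          ≡⟨ cong (λ y → supersets ((i , x) ∷ B) i * y * (n i * Rₙ)) (prodExcept-cong i same) ⟩
      supersets ((i , x) ∷ B) i * R * (n i * Rₙ)           ≡⟨ cong (λ y → ways y (n i ∸ y) (k i) * R * (n i * Rₙ)) bump ⟩
      w * R * (n i * Rₙ)                                   ≡⟨ lem₁ w R (n i) Rₙ ⟩
      w * n i * (R * Rₙ)                                   ≤⟨ *-monoˡ-≤ (R * Rₙ) ratio ⟩
      ways b (n i ∸ b) (k i) * k i * (R * Rₙ)              ≡⟨ lem₂ (ways b (n i ∸ b) (k i)) (k i) R Rₙ ⟩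
      k i * Rₙ * (ways b (n i ∸ b) (k i) * R)              ≡⟨ cong (k i * Rₙ *_) (prod-split i (supersets B)) ⟨
      k i * Rₙ * prod (supersets B)                        ∎
      where
      b = blockSize B i
      R = prodExcept ℓ i (supersets B)
      R′ = prodExcept ℓ i (supersets ((i , x) ∷ B))
      Rₙ = prodExcept ℓ i n
      w = ways (suc b) (n i ∸ suc b) (k i)
      same : ∀ j → j ≢ i → supersets ((i , x) ∷ B) j ≡ supersets B j
      same j j≢i = cong (λ y → ways (y + blockSize B j) (n j ∸ (y + blockSize B j)) (k j)) (spike-other 1 j≢i)
      bump : blockSize ((i , x) ∷ B) i ≡ suc b
      bump = cong (_+ b) (spike-same 1 i)
      b<n : b < n i
      b<n = subst (_≤ n i) bump (blockSize≤ ((i , x) ∷ B) u i)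
      ratio : w * n i ≤ ways b (n i ∸ b) (k i) * k i
      ratio = subst₂ (λ y z → w * y ≤ ways b z (k i) * k i) (m+[n∸m]≡n b<n) (sym (∸-suc< b<n)) (ways-ratio b (n i ∸ suc b) (k i))
      lem₁ : ∀ w R n Rₙ → w * R * (n * Rₙ) ≡ w * n * (R * Rₙ)
      lem₁ = solve-∀
      lem₂ : ∀ w k R Rₙ → w * k * (R * Rₙ) ≡ k * Rₙ * (w * R)
      lem₂ = solve-∀

    module _ {{_ : NonZero L}} (Xm : ℕ) (X≤Xm : ∀ v → X v ≤ Xm) where

      open Spread vertices vertices-complete L N Xm X≤Xm using (scale; weight)

      supersets-weight : ∀ B → Unique B → prod (supersets B) * scale B ≤ weight B
      supersets-weight [] _ = ≤-reflexive (*-identityʳ _)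
      supersets-weight (v ∷ B) u@(_ ∷ u′) = begin
        prod (supersets (v ∷ B)) * (L * scale B)       ≡⟨ *-assoc (prod (supersets (v ∷ B))) L (scale B) ⟨
        prod (supersets (v ∷ B)) * L * scale B         ≤⟨ *-monoˡ-≤ (scale B) (supersets-∷ v B u) ⟩
        X v * prod (supersets B) * scale B             ≡⟨ *-assoc (X v) _ (scale B) ⟩
        X v * (prod (supersets B) * scale B)           ≤⟨ *-monoʳ-≤ (X v) (supersets-weight B u′) ⟩
        X v * weight B                                 ∎

      product-spread : ∀ {B} → Unique B → count (contains? B) 𝓕 * scale B ≤ weight B
      product-spread {B} u = ≤-trans (*-monoˡ-≤ (scale B) (count-contains B u)) (supersets-weight B u)

-- If each of r steps removes a proportion X/L of P, and P stays above (1 - 1/Q) N, then P loses r (X/L) (1 - 1/Q) N in total.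
telescope : ∀ Q X L N r (P : ℕ → ℕ) → (∀ t → t < r → X * P t + L * P (suc t) ≤ L * P t) →
  (∀ t → t < r → Q * N ≤ suc Q * P t) → suc Q * (L * P r) + r * (X * (Q * N)) ≤ suc Q * (L * P 0)
telescope Q X L N zero P _ _ = ≤-reflexive (+-identityʳ _)
telescope Q X L N (suc r) P step low = begin
  suc Q * (L * P (suc r)) + (X * (Q * N) + r * (X * (Q * N)))      ≤⟨ +-monoʳ-≤ (suc Q * (L * P (suc r))) (+-monoˡ-≤ _ (*-monoʳ-≤ X (low r ≤-refl))) ⟩
  suc Q * (L * P (suc r)) + (X * (suc Q * P r) + r * (X * (Q * N)))  ≡⟨ lem (suc Q) (L * P (suc r)) X (P r) _ ⟩
  suc Q * (X * P r + L * P (suc r)) + r * (X * (Q * N))            ≤⟨ +-monoˡ-≤ _ (*-monoʳ-≤ (suc Q) (step r ≤-refl)) ⟩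
  suc Q * (L * P r) + r * (X * (Q * N))                            ≤⟨ telescope Q X L N r P (λ t t<r → step t (m≤n⇒m≤1+n t<r)) (λ t t<r → low t (m≤n⇒m≤1+n t<r)) ⟩
  suc Q * (L * P 0)                                                ∎
  where
  lem : ∀ q y X P z → q * y + (X * (q * P) + z) ≡ q * (X * P + y) + z
  lem = solve-∀

-- Writing q = p + 1, the constants 5q-1 and 3q+1 of the greedy argument turn into the factor 1 - 1/(4q).
sharpen : ∀ p c L Z → 4 * (c * L * (3 * p + 4)) ≤ (2 * p + (3 * p + 4) + (3 * p + 4) + (3 * p + 4)) * Z →
  c * L * (4 * p + 4) ≤ (4 * p + 3) * Z
sharpen p c L Z h = *-cancelˡ-≤ (4 * (4 + 3 * p)) (begin
  4 * (4 + 3 * p) * (c * L * (4 * p + 4))                                         ≡⟨ lem₁ p (c * L) ⟩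
  (4 * p + 4) * (4 * (c * L * (3 * p + 4)))                                       ≤⟨ *-monoʳ-≤ (4 * p + 4) h ⟩
  (4 * p + 4) * ((2 * p + (3 * p + 4) + (3 * p + 4) + (3 * p + 4)) * Z)           ≤⟨ m≤m+n _ ((4 * (p * p) + 8 * p) * Z) ⟩
  (4 * p + 4) * ((2 * p + (3 * p + 4) + (3 * p + 4) + (3 * p + 4)) * Z) + (4 * (p * p) + 8 * p) * Z
                                                                                  ≡⟨ lem₂ p Z ⟩
  4 * (4 + 3 * p) * ((4 * p + 3) * Z)                                             ∎)
  where
  lem₁ : ∀ p y → 4 * (4 + 3 * p) * (y * (4 * p + 4)) ≡ (4 * p + 4) * (4 * (y * (3 * p + 4)))
  lem₁ = solve-∀
  lem₂ : ∀ p Z → (4 * p + 4) * ((2 * p + (3 * p + 4) + (3 * p + 4) + (3 * p + 4)) * Z) + (4 * (p * p) + 8 * p) * Z ≡ 4 * (4 + 3 * p) * ((4 * p + 3) * Z)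
  lem₂ = solve-∀

-- Comparison with the members of the product that meet s vertices

module Extremal {ℓ : ℕ} (n k : Fin (suc ℓ) → ℕ) (s : ℕ) (n≥1 : ∀ i → 1 ≤ n i) (s≤n : ∀ i → s ≤ n i)
  (i₀ : Fin (suc ℓ)) (maximal : ∀ i → k i * prodExcept (suc ℓ) i n ≤ k i₀ * prodExcept (suc ℓ) i₀ n) where

  L N Xm : ℕ
  L = prod n
  N = prod (λ i → n i C k i)
  Xm = k i₀ * prodExcept (suc ℓ) i₀ n

  c : Fin (suc ℓ) → ℕ → ℕ
  c i t = (n i ∸ t) C k i

  instance
    L≢0 : NonZero L
    L≢0 = >-nonZero (prod-positive n≥1)

  module _ (h : Fin (suc ℓ) → ℕ) (r : ℕ) (h+r≡s : total h + r ≡ s) where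

    -- The extra vertices go to block `i₀`, where k_i / n_i is largest and with it the guaranteed
    -- gain per vertex.
    raised : ℕ → Fin (suc ℓ) → ℕ
    raised t j = h j + spike t i₀ j

    total-raised : ∀ t → total (raised t) ≡ total h + t
    total-raised t = trans (total-+ h (spike t i₀)) (cong (total h +_) (total-spike t i₀))

    P : ℕ → ℕ
    P t = prod (λ j → c j (raised t j))

    R : ℕ
    R = prodExcept (suc ℓ) i₀ (λ j → c j (h j))

    P-split : ∀ t → P t ≡ c i₀ (h i₀ + t) * R
    P-split t = trans (prod-split i₀ (λ j → c j (raised t j))) (cong₂ (λ x y → c i₀ (h i₀ + x) * y) (spike-same t i₀)
      (prodExcept-cong i₀ (λ j j≢ → cong (c j) (trans (cong (h j +_) (spike-other t j≢)) (+-identityʳ (h j))))))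

    P-zero : P 0 ≡ prod (λ j → c j (h j))
    P-zero = trans (P-split 0) (trans (cong (λ x → c i₀ x * R) (+-identityʳ (h i₀))) (sym (prod-split i₀ (λ j → c j (h j)))))

    P-step : ∀ t → t < r → Xm * P t + L * P (suc t) ≤ L * P t
    P-step t t<r = begin
      Xm * P t + L * P (suc t)
        ≡⟨ cong₂ (λ x y → Xm * x + L * y) (P-split t) (trans (P-split (suc t)) (cong (λ x → c i₀ x * R) (+-suc (h i₀) t))) ⟩
      Xm * (c i₀ u * R) + L * (c i₀ (suc u) * R)
        ≡⟨ cong (λ x → Xm * (c i₀ u * R) + x * (c i₀ (suc u) * R)) (prod-split i₀ n) ⟩
      k i₀ * Rₙ * (c i₀ u * R) + n i₀ * Rₙ * (c i₀ (suc u) * R)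
        ≡⟨ lem (k i₀) Rₙ (c i₀ u) R (n i₀) (c i₀ (suc u)) ⟩
      (k i₀ * c i₀ u + n i₀ * c i₀ (suc u)) * (Rₙ * R)
        ≤⟨ *-monoˡ-≤ (Rₙ * R) (C-gain (n i₀) (k i₀) u u<n) ⟩
      n i₀ * c i₀ u * (Rₙ * R)
        ≡⟨ lem₂ (n i₀) (c i₀ u) Rₙ R ⟩
      n i₀ * Rₙ * (c i₀ u * R)
        ≡⟨ cong₂ _*_ (prod-split i₀ n) (P-split t) ⟨
      L * P t ∎
      where
      u = h i₀ + t
      Rₙ = prodExcept (suc ℓ) i₀ n
      u<n : u < n i₀
      u<n = begin-strict
        h i₀ + t       ≤⟨ +-monoˡ-≤ t (≤-sum h i₀) ⟩
        total h + t    <⟨ +-monoʳ-< (total h) t<r ⟩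
        total h + r    ≡⟨ h+r≡s ⟩
        s              ≤⟨ s≤n i₀ ⟩
        n i₀           ∎
      lem : ∀ k Rₙ c R n d → k * Rₙ * (c * R) + n * Rₙ * (d * R) ≡ (k * c + n * d) * (Rₙ * R)
      lem = solve-∀
      lem₂ : ∀ n c Rₙ R → n * c * (Rₙ * R) ≡ n * Rₙ * (c * R)
      lem₂ = solve-∀

    -- At most s vertices have been removed and each meets at most a proportion Xm / L of the
    -- product, so at most a proportion 1 / (Q + 1) is lost.
    P-lower : ∀ Q → suc Q * (s * Xm) ≤ L → ∀ t → t < r → Q * N ≤ suc Q * P t
    P-lower Q small t t<r = *-cancelˡ-≤ L (+-cancelʳ-≤ (L * N) _ _ (begin
      L * (Q * N) + L * N                                    ≡⟨ lem L Q N ⟩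
      suc Q * (L * N)                                        ≤⟨ *-monoʳ-≤ (suc Q) (prod-loss L Xm (λ j → c j (raised t j)) (λ j → c j 0) (raised t)
                                                                  (λ j → C-monoˡ (k j) (m∸n≤m (n j) (raised t j))) loss) ⟩
      suc Q * (L * P t + total (raised t) * (Xm * N))        ≤⟨ *-monoʳ-≤ (suc Q) (+-monoʳ-≤ (L * P t) (*-monoˡ-≤ (Xm * N) raised≤s)) ⟩
      suc Q * (L * P t + s * (Xm * N))                       ≡⟨ lem₂ (suc Q) L (P t) s Xm N ⟩
      L * (suc Q * P t) + suc Q * (s * Xm) * N               ≤⟨ +-monoʳ-≤ _ (*-monoˡ-≤ N small) ⟩
      L * (suc Q * P t) + L * N                              ∎))
      where
      lem : ∀ L Q N → L * (Q * N) + L * N ≡ (1 + Q) * (L * N)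
      lem = solve-∀
      lem₂ : ∀ q L P s X N → q * (L * P + s * (X * N)) ≡ L * (q * P) + q * (s * X) * N
      lem₂ = solve-∀
      lem₃ : ∀ n R c → n * R * c ≡ R * (n * c)
      lem₃ = solve-∀
      regroup : ∀ R n d h k c → R * (n * d + h * (k * c)) ≡ n * R * d + h * (k * R * c)
      regroup = solve-∀
      raised≤s : total (raised t) ≤ s
      raised≤s = begin
        total (raised t)  ≡⟨ total-raised t ⟩
        total h + t       ≤⟨ +-monoʳ-≤ (total h) (<⇒≤ t<r) ⟩
        total h + r       ≡⟨ h+r≡s ⟩
        s                 ∎
      Rₙ : Fin (suc ℓ) → ℕ
      Rₙ j = prodExcept (suc ℓ) j n
      loss : ∀ j → L * c j 0 ≤ L * c j (raised t j) + raised t j * (Xm * c j 0)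
      loss j = begin
        L * c j 0                                                          ≡⟨ cong (_* c j 0) (prod-split j n) ⟩
        n j * Rₙ j * c j 0                                                   ≡⟨ lem₃ (n j) (Rₙ j) (c j 0) ⟩
        Rₙ j * (n j * c j 0)                                                 ≤⟨ *-monoʳ-≤ (Rₙ j) (C-loss (n j) (k j) (raised t j) (≤-trans (≤-sum (raised t) j) (≤-trans raised≤s (s≤n j)))) ⟩
        Rₙ j * (n j * c j (raised t j) + raised t j * (k j * c j 0))         ≡⟨ regroup (Rₙ j) (n j) (c j (raised t j)) (raised t j) (k j) (c j 0) ⟩
        n j * Rₙ j * c j (raised t j) + raised t j * (k j * Rₙ j * c j 0)      ≡⟨ cong (λ x → x * c j (raised t j) + raised t j * (k j * Rₙ j * c j 0)) (prod-split j n) ⟨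
        L * c j (raised t j) + raised t j * (k j * Rₙ j * c j 0)             ≤⟨ +-monoʳ-≤ _ (*-monoʳ-≤ (raised t j) (*-monoˡ-≤ (c j 0) (maximal j))) ⟩
        L * c j (raised t j) + raised t j * (Xm * c j 0)                   ∎

    -- By `telescope`, r more vertices in block `i₀` remove at least f members of the product, which
    -- pays for the f edges avoiding the first vertices. So F is at most the number of members
    -- meeting s vertices, and `concentrate` moves these into a single block.
    optimum : ∀ Q F f → suc Q * (s * Xm) ≤ L → f * L * suc Q ≤ Q * (r * Xm * N) →
      F + prod (λ j → c j (h j)) ≤ N + f → F ≤ bound (suc ℓ) s n k
    optimum Q F f small few total≤ = finish (concentrate s c two (raised r) raised-s≤)
      where
      raised-s≤ : total (raised r) ≤ s
      raised-s≤ = ≤-reflexive (trans (total-raised r) h+r≡s)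
      two : ∀ i j a b → a + b ≤ s → (c i (a + b) * c j 0 ≤ c i a * c j b) ⊎ (c i 0 * c j (a + b) ≤ c i a * c j b)
      two i j a b le = two-blocks (n i) (k i) (n j) (k j) a b (≤-trans le (s≤n i)) (≤-trans le (s≤n j))
      f+Pr : f + P r ≤ P 0
      f+Pr = *-cancelˡ-≤ (suc Q * L) {{m*n≢0 (suc Q) L}} (begin
        suc Q * L * (f + P r)                               ≡⟨ lem (suc Q) L f (P r) ⟩
        f * L * suc Q + suc Q * (L * P r)                   ≤⟨ +-monoˡ-≤ _ few ⟩
        Q * (r * Xm * N) + suc Q * (L * P r)                ≡⟨ lem₂ Q r Xm N (suc Q * (L * P r)) ⟩
        suc Q * (L * P r) + r * (Xm * (Q * N))              ≤⟨ telescope Q Xm L N r P P-step (P-lower Q small) ⟩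
        suc Q * (L * P 0)                                   ≡⟨ *-assoc (suc Q) L (P 0) ⟨
        suc Q * L * P 0                                     ∎)
        where
        lem : ∀ q L f P → q * L * (f + P) ≡ f * L * q + q * (L * P)
        lem = solve-∀
        lem₂ : ∀ Q r X N y → Q * (r * X * N) + y ≡ y + r * (X * (Q * N))
        lem₂ = solve-∀
      finish : (∃ λ i → prod (λ j → c j (spike (total (raised r)) i j)) ≤ P r) → F ≤ bound (suc ℓ) s n k
      finish (i , le) = ≤-trans (begin
          F                                            ≡⟨ m+n∸n≡m F (c i s * E) ⟨
          F + c i s * E ∸ c i s * E                    ≤⟨ ∸-monoˡ-≤ (c i s * E) upper ⟩
          N ∸ c i s * E                                ≡⟨ cong (_∸ c i s * E) (prod-split i (λ j → c j 0)) ⟩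
          c i 0 * E ∸ c i s * E                        ≡⟨ *-distribʳ-∸ E (c i 0) (c i s) ⟨
          (c i 0 ∸ c i s) * E                          ∎)
        (≤-maxFin (λ i → (c i 0 ∸ c i s) * prodExcept (suc ℓ) i (λ j → c j 0)) i)
        where
        E = prodExcept (suc ℓ) i (λ j → c j 0)
        extremal : c i s * E ≤ P r
        extremal = ≤-trans (≤-reflexive (sym (trans (cong (λ t → prod (λ j → c j (spike t i j))) (trans (total-raised r) h+r≡s)) (prod-spike c s i)))) le
        upper : F + c i s * E ≤ N
        upper = +-cancelʳ-≤ f _ _ (begin
          F + c i s * E + f                    ≡⟨ lem F (c i s * E) f ⟩
          F + (f + c i s * E)                  ≤⟨ +-monoʳ-≤ F (≤-trans (+-monoʳ-≤ f extremal) f+Pr) ⟩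
          F + P 0                              ≡⟨ cong (F +_) P-zero ⟩
          F + prod (λ j → c j (h j))           ≤⟨ total≤ ⟩
          N + f                                ∎)
          where
          lem : ∀ a b c → a + b + c ≡ a + (c + b)
          lem = solve-∀

-- Choice of the constants and conclusion

module Matching-bound {ℓ : ℕ} (n k : Fin (suc ℓ) → ℕ) (s : ℕ) (n≥1 : ∀ i → 1 ≤ n i) (k≥1 : ∀ i → 1 ≤ k i) (s≤n : ∀ i → s ≤ n i)
  (𝓕 : List (GSet (suc ℓ) n)) (distinct : IsFamily 𝓕) (sizes : All (InProduct n k) 𝓕) (ν≤s : MatchingNumberAtMost 𝓕 s) where

  open Blocks n
  open Family k 𝓕 distinct sizes
  open Hypergraph _≟ᵥ_ verticesOf 𝓕 X using (_#_; others; avoids?)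

  Y₀ : ℕ
  Y₀ = total (λ i → k i * Xᵢ i)

  i₀ : Fin (suc ℓ)
  i₀ = proj₁ (argmax Xᵢ)

  maximal : ∀ i → Xᵢ i ≤ Xᵢ i₀
  maximal = proj₂ (argmax Xᵢ)

  #⇒Disjoint : ∀ {F G} → F # G → Disjoint F G
  #⇒Disjoint {F} {G} F#G i (x , x∈) with x∈F , x∈G ← x∈p∩q⁻ (F i) (G i) x∈ =
    F#G (∈-verticesOf⁺ F (Vecₚ.[]=⇒lookup x∈F)) (∈-verticesOf⁺ G (Vecₚ.[]=⇒lookup x∈G))

  edge-size : ∀ {F} → F ∈ 𝓕 → length (verticesOf F) ≤ total k
  edge-size {F} F∈ = ≤-reflexive (trans (length-verticesOf F) (total-cong {f = λ i → ∣ F i ∣} (All.lookup sizes F∈)))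

  edge-sum : ∀ {F} → F ∈ 𝓕 → sumBy X (verticesOf F) ≤ Y₀
  edge-sum {F} F∈ = ≤-reflexive (trans (sumBy-verticesOf Xᵢ F)
    (total-cong {f = λ i → ∣ F i ∣ * Xᵢ i} {λ i → k i * Xᵢ i} (λ i → cong (_* Xᵢ i) (All.lookup sizes F∈ i))))

  sumBy-others : ∀ {v} xs → v ∈ xs → sumBy X (others v xs) + X v ≤ sumBy X xs
  sumBy-others {v} (u ∷ xs) v∈ with u ≟ᵥ v
  ... | yes refl = ≤-trans (+-monoˡ-≤ (X v) (sumBy-filter X (λ w → ¬? (w ≟ᵥ v)) xs)) (≤-reflexive (+-comm _ (X v)))
  ... | no u≢v = ≤-trans (≤-reflexive (+-assoc (X u) _ (X v))) (+-monoʳ-≤ (X u) (sumBy-others xs (later v∈)))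
    where
    later : v ∈ u ∷ xs → v ∈ xs
    later (here v≡u) = contradiction (sym v≡u) u≢v
    later (there v∈) = v∈

  Xᵢ≤Y₀ : ∀ i → Xᵢ i ≤ Y₀
  Xᵢ≤Y₀ i = ≤-trans (≤-trans (≤-reflexive (sym (*-identityˡ (Xᵢ i)))) (*-monoˡ-≤ (Xᵢ i) (k≥1 i))) (≤-sum (λ i → k i * Xᵢ i) i)

  -- Here p + 1 is the q of the factor 1 - 1/(4q). For S = 2p and D = 3p + 4 the quotient S / (S +
  -- 2D) is p / (4(p + 1)), so `Y-small` bounds s Y / L by this number.
  module _ (p Y : ℕ) (Y₀≤ : ∀ i → Y₀ ≤ Y + Xᵢ i)
    (Y-small : (2 * p + (3 * p + 4) + (3 * p + 4)) * (s * Y) ≤ 2 * p * L)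
    (Y₀-small : 4 * (s * Y₀) ≤ L) (Xm-small : suc (4 * p + 3) * (s * Xᵢ i₀) ≤ L) where

    open Extremal n k s n≥1 s≤n i₀ maximal using (L≢0; optimum)

    link-sum : ∀ {v F} → F ∈ 𝓕 → v ∈ verticesOf F → sumBy X (others v (verticesOf F)) ≤ Y
    link-sum {v} {F} F∈ v∈ = +-cancelʳ-≤ (X v) _ _ (≤-trans (sumBy-others (verticesOf F) v∈) (≤-trans (edge-sum F∈) (Y₀≤ (proj₁ v))))

    ν : ∀ M → All (_∈ 𝓕) M → AllPairs _#_ M → length M ≤ s
    ν M M⊆ M# = ν≤s M M⊆ (AllPairs.map #⇒Disjoint M#)

    conclusion : length 𝓕 ≤ bound (suc ℓ) s n k
    conclusion = conclude (Structure.Bounded.few-avoid-centres _≟ᵥ_ verticesOf 𝓕 X vertices vertices-complete vertices!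
        -- The empty set is a default value for `e₀` and need not belong to `𝓕`.
        L N (Xᵢ i₀) (maximal ∘ proj₁) (product-spread (Xᵢ i₀) (maximal ∘ proj₁)) (λ _ → Vec.replicate _ outside)
        (2 * p) (3 * p + 4) s Y Y₀ (total k) edge-size edge-sum link-sum (Xᵢ≤Y₀ i₀) Y₀-small Y-small ν)
      where
      conclude : (∃ λ H → Unique H × length H ≤ s ×
          4 * (count (avoids? H) 𝓕 * L * (3 * p + 4)) ≤
            (2 * p + (3 * p + 4) + (3 * p + 4) + (3 * p + 4)) * ((s ∸ length H) * Xᵢ i₀ * N)) →
        length 𝓕 ≤ bound (suc ℓ) s n k
      conclude (H , H! , H≤s , few) = optimum (blockSize H) (s ∸ length H)
        (trans (cong (_+ (s ∸ length H)) (total-blockSize H)) (m+[n∸m]≡n H≤s))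
        -- The choice Q = 4p + 3 makes Q / (Q + 1) equal to 1 - 1/(4q), the factor supplied by
        -- `sharpen`.
        (4 * p + 3) (length 𝓕) (count (avoids? H) 𝓕) Xm-small
        (subst (λ q → count (avoids? H) 𝓕 * L * q ≤ (4 * p + 3) * ((s ∸ length H) * Xᵢ i₀ * N)) (+-suc (4 * p) 3)
          (sharpen p (count (avoids? H) 𝓕) L ((s ∸ length H) * Xᵢ i₀ * N) few))
        (avoid-bound H H!)

theorem1p4 : (ℓ s : ℕ) (n k : Fin ℓ → ℕ) →
    1 ≤ ℓ → 1 ≤ s → (∀ i → 1 ≤ n i) → (∀ i → 1 ≤ k i) →
    (∀ i → 4 * ℓ ^ 2 * k i ^ 2 * s ≤ n i) →
    (𝓕 : List (GSet ℓ n)) → IsFamily 𝓕 → All (InProduct n k) 𝓕 →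
    MatchingNumberAtMost 𝓕 s →
    length 𝓕 ≤ bound ℓ s n k
theorem1p4 (suc ℓ) s n k _ _ n≥1 k≥1 n-large 𝓕 distinct sizes ν≤s = by-blocks ℓ refl
  where
  instance
    k≢0 : ∀ {i} → NonZero (k i)
    k≢0 {i} = >-nonZero (k≥1 i)

  s≤n : ∀ i → s ≤ n i
  s≤n i = ≤-trans (m≤n*m s (4 * suc ℓ ^ 2 * k i ^ 2) {{m*n≢0 (4 * suc ℓ ^ 2) (k i ^ 2) {{m*n≢0 4 (suc ℓ ^ 2) {{_}} {{m^n≢0 (suc ℓ) 2}}}} {{m^n≢0 (k i) 2}}}}) (n-large i)

  open Matching-bound n k s n≥1 k≥1 s≤n 𝓕 distinct sizes ν≤s
  open Blocks n
  open Family k 𝓕 distinct sizes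

  -- The size hypothesis times the sizes of the other blocks. The number of blocks is `suc ℓ` from
  -- here on.
  block-small : ∀ i → 4 * suc ℓ * suc ℓ * s * (k i * Xᵢ i) ≤ L
  block-small i = begin
    4 * suc ℓ * suc ℓ * s * (k i * (k i * R))       ≡⟨ lem (suc ℓ) s (k i) R ⟩
    4 * suc ℓ ^ 2 * k i ^ 2 * s * R                 ≤⟨ *-monoˡ-≤ R (n-large i) ⟩
    n i * R                                         ≡⟨ prod-split i n ⟨
    L                                               ∎
    where
    R = prodExcept (suc ℓ) i n
    lem : ∀ l s k R → 4 * l * l * s * (k * (k * R)) ≡ 4 * (l * (l * 1)) * (k * (k * 1)) * s * R
    lem = solve-∀

  -- Summation over the blocks turns the square of the number of blocks into its first power.
  Y₀-bound : 4 * suc ℓ * s * Y₀ ≤ L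
  Y₀-bound = *-cancelˡ-≤ (suc ℓ) (begin
    suc ℓ * (4 * suc ℓ * s * Y₀)                                      ≡⟨ lem (suc ℓ) s Y₀ ⟩
    4 * suc ℓ * suc ℓ * s * Y₀                                        ≡⟨ total-* (4 * suc ℓ * suc ℓ * s) (λ i → k i * Xᵢ i) ⟨
    total (λ i → 4 * suc ℓ * suc ℓ * s * (k i * Xᵢ i))                ≤⟨ total-mono {f = λ i → 4 * suc ℓ * suc ℓ * s * (k i * Xᵢ i)} {λ _ → L} block-small ⟩
    total (λ (_ : Fin (suc ℓ)) → L)                                   ≡⟨ total-const (suc ℓ) L ⟩
    suc ℓ * L                                                         ∎)
    where
    lem : ∀ l s y → l * (4 * l * s * y) ≡ 4 * l * l * s * y
    lem = solve-∀

  Y₀-small : 4 * (s * Y₀) ≤ L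
  Y₀-small = ≤-trans (≤-trans (m≤n*m (4 * (s * Y₀)) (suc ℓ)) (≤-reflexive (lem (suc ℓ) s Y₀))) Y₀-bound
    where
    lem : ∀ l s y → l * (4 * (s * y)) ≡ 4 * l * s * y
    lem = solve-∀

  -- The equation allows a case distinction on `ℓ` although the modules are already opened at `ℓ`.
  by-blocks : ∀ m → ℓ ≡ m → length 𝓕 ≤ bound (suc ℓ) s n k
  -- With one block all vertices weigh the same and a link has p = k - 1 vertices, so Y is p times
  -- that weight. The two other smallness conditions then both reduce to `Y₀-small`.
  by-blocks zero refl = conclusion p (p * Xᵢ zero)
    (λ { zero → ≤-reflexive (trans Y₀≡ (+-comm (Xᵢ zero) _)) })
    (begin
      (2 * p + (3 * p + 4) + (3 * p + 4)) * (s * (p * Xᵢ zero))      ≡⟨ lem₁ p s (Xᵢ zero) ⟩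
      2 * p * (4 * (s * (Xᵢ zero + p * Xᵢ zero)))                    ≡⟨ cong (λ y → 2 * p * (4 * (s * y))) Y₀≡ ⟨
      2 * p * (4 * (s * Y₀))                                         ≤⟨ *-monoʳ-≤ (2 * p) Y₀-small ⟩
      2 * p * L                                                      ∎)
    Y₀-small
    (begin
      suc (4 * p + 3) * (s * Xᵢ i₀)                                  ≤⟨ *-monoʳ-≤ (suc (4 * p + 3)) (*-monoʳ-≤ s (only i₀)) ⟩
      suc (4 * p + 3) * (s * Xᵢ zero)                                ≡⟨ lem₂ p s (Xᵢ zero) ⟩
      4 * (s * (Xᵢ zero + p * Xᵢ zero))                              ≡⟨ cong (λ y → 4 * (s * y)) Y₀≡ ⟨
      4 * (s * Y₀)                                                   ≤⟨ Y₀-small ⟩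
      L                                                              ∎)
    where
    p = k zero ∸ 1
    Y₀≡ : Y₀ ≡ Xᵢ zero + p * Xᵢ zero
    Y₀≡ = trans (+-identityʳ (k zero * Xᵢ zero)) (cong (_* Xᵢ zero) (sym (m+[n∸m]≡n (k≥1 zero))))
    only : ∀ (i : Fin 1) → Xᵢ i ≤ Xᵢ zero
    only zero = ≤-refl
    lem₁ : ∀ p s x → (2 * p + (3 * p + 4) + (3 * p + 4)) * (s * (p * x)) ≡ 2 * p * (4 * (s * (x + p * x)))
    lem₁ = solve-∀
    lem₂ : ∀ p s x → (1 + (4 * p + 3)) * (s * x) ≡ 4 * (s * (x + p * x))
    lem₂ = solve-∀
  -- With at least two blocks `Y₀-bound` gives 8 s Y₀ ≤ L. This is the bound p / (4(p + 1)) = 1/8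
  -- for p = 1, so Y = Y₀ will do.
  by-blocks (suc m) refl = conclusion 1 Y₀
    (λ i → m≤m+n Y₀ _)
    (begin
      16 * (s * Y₀)                                  ≡⟨ lem₁ s Y₀ ⟩
      2 * (8 * (s * Y₀))                             ≤⟨ *-monoʳ-≤ 2 eight ⟩
      2 * L                                          ∎)
    Y₀-small
    (≤-trans (*-monoʳ-≤ 8 (*-monoʳ-≤ s (Xᵢ≤Y₀ i₀))) eight)
    where
    lem₁ : ∀ s y → 16 * (s * y) ≡ 2 * (8 * (s * y))
    lem₁ = solve-∀
    lem₂ : ∀ m s y → 8 * (s * y) + 4 * m * s * y ≡ 4 * (2 + m) * s * y
    lem₂ = solve-∀
    eight : 8 * (s * Y₀) ≤ L
    eight = ≤-trans (≤-trans (m≤m+n _ (4 * m * s * Y₀)) (≤-reflexive (lem₂ m s Y₀))) Y₀-bound
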